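{- For every valid lattice $L\subset\mathbb{Z}^2$, the set $\mathscr{F}(L)$ of all flux values of domino tilings of the torus $\mathbb{T}_L=\mathbb{R}^2/L$ is $$\mathscr{F}(L)=L^{\#}\cap Q,\qquad Q=\{(x,y)\in\mathbb{R}^2:\ |x|+|y|\le \tfrac12\}.$$
   Context: Coloring and tilings: the unit square $[i,i+1]\times[j,j+1]$ ($i,j\in\mathbb{Z}$) is black if $i+j$ is even and white otherwise. A domino is the union of two unit squares sharing a side. A tiling of $\mathbb{Z}^2$ is a set of dominoes with pairwise disjoint interiors covering $\mathbb{R}^2$. Valid lattices: let $\mathscr{E}=2\mathbb{Z}^2$ and $\mathscr{O}=2\mathbb{Z}^2+(1,1)$. A valid lattice is a subgroup $L\subset\mathbb{Z}^2$ generated by two linearly independent vectors $v_0,v_1\in\mathscr{E}\sqcup\mathscr{O}$. A tiling of $\mathbb{T}_L=\mathbb{R}^2/L$ is identified with an $L$-periodic tiling of $\mathbb{Z}^2$. Height functions: each unit edge between neighboring points of $\mathbb{Z}^2$ is oriented so that the boundary of every black square is oriented clockwise (hence the boundary of every white square counterclockwise). The height function $h_t:\mathbb{Z}^2\to\mathbb{Z}$ of a tiling $t$ is the unique function with $h_t(0)=0$ such that for every edge oriented from $u$ to $w$: $h_t(w)=h_t(u)+1$ if the edge does not cross a domino of $t$ (i.e. is not the common side of the two squares of a domino of $t$), and $h_t(w)=h_t(u)-3$ otherwise. Flux: for a tiling $t$ of $\mathbb{T}_L$, $h_t(u+v)-h_t(u)$ depends only on $v\in L$ (not on $u\in\mathbb{Z}^2$)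 and is additive in $v$; the flux of $t$ is the unique $\varphi_t\in\mathbb{R}^2$ with $4\langle\varphi_t,v\rangle=h_t(u+v)-h_t(u)$ for all $v\in L$, $u\in\mathbb{Z}^2$. $\mathscr{F}(L)=\{\varphi_t: t \text{ a tiling of }\mathbb{T}_L\}$. $L^{\#}$: with $L$ generated by two linearly independent vectors $v_0,v_1\in\mathscr{E}\sqcup\mathscr{O}$, $L^{\#}$ is the set of $\varphi\in\mathbb{R}^2$ such that for each $i\in\{0,1\}$: $\langle\varphi,v_i\rangle\in\mathbb{Z}$ if $v_i\in\mathscr{E}$ and $\langle\varphi,v_i\rangle\in\mathbb{Z}+\frac12$ if $v_i\in\mathscr{O}$ (this does not depend on the choice of basis). -}

module Defs where

open import Data.Integer.Base as ℤ using (ℤ; +_; 0ℤ; 1ℤ)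
open import Data.Integer.Divisibility using (_∣_)
open import Data.Nat.Base as ℕ using (ℕ; _⊔_)
import Data.Nat.Properties as ℕ
open import Data.Product.Base using (Σ; ∃; ∃₂; _×_; _,_; proj₁; proj₂; ∃-syntax)
open import Data.Rational.Base as ℚ using (ℚ; 0ℚ; 1ℚ; ½; positive)
import Data.Rational.Properties as ℚ
open import Data.Rational.Solver using (module +-*-Solver)
open import Data.Sum.Base using (_⊎_; inj₁; inj₂)
open import Level as Level using (0ℓ)
open import Relation.Binary.PropositionalEquality.Core
  using (_≡_; refl; sym; trans; cong; subst)
open import Relation.Nullary.Negation.Core using (¬_)
open import Relation.Unary using (Pred; _∈_)

------------------------------------------------------------------------
-- Real numbers: Cauchy sequences of rationals, compared by the setoid
-- equality _≈_.  Only the operations needed below are provided; in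
-- particular, inner products with integer vectors only require
-- multiplication by rational constants.

IsCauchy : (ℕ → ℚ) → Set
IsCauchy x = ∀ ε → 0ℚ ℚ.< ε →
  ∃[ N ] (∀ m n → N ℕ.≤ m → N ℕ.≤ n → ℚ.∣ x m ℚ.- x n ∣ ℚ.< ε)

record ℝ : Set where
  constructor mkℝ
  field
    seq    : ℕ → ℚ
    cauchy : IsCauchy seq

open ℝ public

infix 4 _≈_ _≤_

_≈_ : ℝ → ℝ → Set
x ≈ y = ∀ ε → 0ℚ ℚ.< ε →
  ∃[ N ] (∀ n → N ℕ.≤ n → ℚ.∣ seq x n ℚ.- seq y n ∣ ℚ.< ε)

_≤_ : ℝ → ℝ → Set
x ≤ y = ∀ ε → 0ℚ ℚ.< ε →
  ∃[ N ] (∀ n → N ℕ.≤ n → seq x n ℚ.< seq y n ℚ.+ ε)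

private

  0<½* : ∀ {ε} → 0ℚ ℚ.< ε → 0ℚ ℚ.< ½ ℚ.* ε
  0<½* {ε} 0<ε = subst (ℚ._< ½ ℚ.* ε) (ℚ.*-zeroʳ ½) (ℚ.*-monoʳ-<-pos ½ 0<ε)

  ½*+½* : ∀ ε → ½ ℚ.* ε ℚ.+ ½ ℚ.* ε ≡ ε
  ½*+½* ε = trans (sym (ℚ.*-distribʳ-+ ε ½ ½)) (ℚ.*-identityˡ ε)

  interchange : ∀ a b c d →
    (a ℚ.+ b) ℚ.- (c ℚ.+ d) ≡ (a ℚ.- c) ℚ.+ (b ℚ.- d)
  interchange = solve 4
    (λ a b c d → (a :+ b) :+ :- (c :+ d) := (a :+ :- c) :+ (b :+ :- d)) refl
    where open +-*-Solver

  ∣a∣-∣b∣≤∣a-b∣ : ∀ a b → ℚ.∣ a ∣ ℚ.- ℚ.∣ b ∣ ℚ.≤ ℚ.∣ a ℚ.- b ∣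
  ∣a∣-∣b∣≤∣a-b∣ a b = begin
    ℚ.∣ a ∣ ℚ.- ℚ.∣ b ∣
      ≡⟨ cong (λ c → ℚ.∣ c ∣ ℚ.- ℚ.∣ b ∣) (lem₁ a b) ⟩
    ℚ.∣ (a ℚ.- b) ℚ.+ b ∣ ℚ.- ℚ.∣ b ∣
      ≤⟨ ℚ.+-monoˡ-≤ (ℚ.- ℚ.∣ b ∣) (ℚ.∣p+q∣≤∣p∣+∣q∣ (a ℚ.- b) b) ⟩
    (ℚ.∣ a ℚ.- b ∣ ℚ.+ ℚ.∣ b ∣) ℚ.- ℚ.∣ b ∣
      ≡⟨ lem₂ ℚ.∣ a ℚ.- b ∣ ℚ.∣ b ∣ ⟩
    ℚ.∣ a ℚ.- b ∣ ∎
    where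
    open ℚ.≤-Reasoning
    open +-*-Solver
    lem₁ : ∀ a b → a ≡ (a ℚ.- b) ℚ.+ b
    lem₁ = solve 2 (λ a b → a := (a :+ :- b) :+ b) refl
    lem₂ : ∀ a b → (a ℚ.+ b) ℚ.- b ≡ a
    lem₂ = solve 2 (λ a b → (a :+ b) :+ :- b := a) refl

  ∣∣a∣-∣b∣∣≤∣a-b∣ : ∀ a b → ℚ.∣ ℚ.∣ a ∣ ℚ.- ℚ.∣ b ∣ ∣ ℚ.≤ ℚ.∣ a ℚ.- b ∣
  ∣∣a∣-∣b∣∣≤∣a-b∣ a b with ℚ.∣p∣≡p∨∣p∣≡-p (ℚ.∣ a ∣ ℚ.- ℚ.∣ b ∣)
  ... | inj₁ eq = subst (ℚ._≤ ℚ.∣ a ℚ.- b ∣) (sym eq) (∣a∣-∣b∣≤∣a-b∣ a b)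
  ... | inj₂ eq = begin
    ℚ.∣ ℚ.∣ a ∣ ℚ.- ℚ.∣ b ∣ ∣   ≡⟨ eq ⟩
    ℚ.- (ℚ.∣ a ∣ ℚ.- ℚ.∣ b ∣)   ≡⟨ flip-- ℚ.∣ a ∣ ℚ.∣ b ∣ ⟩
    ℚ.∣ b ∣ ℚ.- ℚ.∣ a ∣         ≤⟨ ∣a∣-∣b∣≤∣a-b∣ b a ⟩
    ℚ.∣ b ℚ.- a ∣               ≡⟨ cong ℚ.∣_∣ (sym (flip-- a b)) ⟩
    ℚ.∣ ℚ.- (a ℚ.- b) ∣         ≡⟨ ℚ.∣-p∣≡∣p∣ (a ℚ.- b) ⟩
    ℚ.∣ a ℚ.- b ∣               ∎
    where
    open ℚ.≤-Reasoning
    open +-*-Solver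
    flip-- : ∀ a b → ℚ.- (a ℚ.- b) ≡ b ℚ.- a
    flip-- = solve 2 (λ a b → :- (a :+ :- b) := b :+ :- a) refl

fromℚ : ℚ → ℝ
fromℚ q = mkℝ (λ _ → q) λ ε 0<ε →
  0 , λ _ _ _ _ → subst (ℚ._< ε) (cong ℚ.∣_∣ (sym (ℚ.+-inverseʳ q))) 0<ε

fromℤ : ℤ → ℝ
fromℤ k = fromℚ (k ℚ./ 1)

infixl 6 _+_
infixl 7 _·_

_+_ : ℝ → ℝ → ℝ
x + y = mkℝ (λ n → seq x n ℚ.+ seq y n) λ ε 0<ε →
  let (M , p) = cauchy x (½ ℚ.* ε) (0<½* 0<ε)
      (N , q) = cauchy y (½ ℚ.* ε) (0<½* 0<ε)
      open ℚ.≤-Reasoning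
  in M ⊔ N , λ m n M⊔N≤m M⊔N≤n → begin-strict
    ℚ.∣ (seq x m ℚ.+ seq y m) ℚ.- (seq x n ℚ.+ seq y n) ∣
      ≡⟨ cong ℚ.∣_∣ (interchange (seq x m) (seq y m) (seq x n) (seq y n)) ⟩
    ℚ.∣ (seq x m ℚ.- seq x n) ℚ.+ (seq y m ℚ.- seq y n) ∣
      ≤⟨ ℚ.∣p+q∣≤∣p∣+∣q∣ (seq x m ℚ.- seq x n) (seq y m ℚ.- seq y n) ⟩
    ℚ.∣ seq x m ℚ.- seq x n ∣ ℚ.+ ℚ.∣ seq y m ℚ.- seq y n ∣
      <⟨ ℚ.+-mono-<
           (p m n (ℕ.m⊔n≤o⇒m≤o M N M⊔N≤m) (ℕ.m⊔n≤o⇒m≤o M N M⊔N≤n))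
           (q m n (ℕ.m⊔n≤o⇒n≤o M N M⊔N≤m) (ℕ.m⊔n≤o⇒n≤o M N M⊔N≤n)) ⟩
    ½ ℚ.* ε ℚ.+ ½ ℚ.* ε
      ≡⟨ ½*+½* ε ⟩
    ε ∎

_·_ : ℚ → ℝ → ℝ
q · x = mkℝ (λ n → q ℚ.* seq x n) isCauchy
  where
  open ℚ.≤-Reasoning
  b : ℚ
  b = ℚ.∣ q ∣ ℚ.+ 1ℚ

  instance
    b-pos : ℚ.Positive b
    b-pos = positive (ℚ.+-mono-≤-< (ℚ.0≤∣p∣ q) (ℚ.positive⁻¹ 1ℚ))
    b-nonZero : ℚ.NonZero b
    b-nonZero = ℚ.pos⇒nonZero b
    1/b-pos : ℚ.Positive (ℚ.1/ b)
    1/b-pos = ℚ.1/pos⇒pos b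

  ∣q∣≤b : ℚ.∣ q ∣ ℚ.≤ b
  ∣q∣≤b = subst (ℚ._≤ b) (ℚ.+-identityʳ ℚ.∣ q ∣)
    (ℚ.+-monoʳ-≤ ℚ.∣ q ∣ (ℚ.<⇒≤ (ℚ.positive⁻¹ 1ℚ)))

  factor : ∀ u v → q ℚ.* u ℚ.- q ℚ.* v ≡ q ℚ.* (u ℚ.- v)
  factor = solve 3
    (λ q u v → q :* u :+ :- (q :* v) := q :* (u :+ :- v)) refl q
    where open +-*-Solver

  isCauchy : IsCauchy (λ n → q ℚ.* seq x n)
  isCauchy ε 0<ε =
    let δ = ℚ.1/ b ℚ.* ε
        0<δ = subst (ℚ._< δ) (ℚ.*-zeroʳ (ℚ.1/ b))
                (ℚ.*-monoʳ-<-pos (ℚ.1/ b) 0<ε)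
        (N , p) = cauchy x δ 0<δ
    in N , λ m n N≤m N≤n →
      let d = seq x m ℚ.- seq x n in begin-strict
      ℚ.∣ q ℚ.* seq x m ℚ.- q ℚ.* seq x n ∣
        ≡⟨ cong ℚ.∣_∣ (factor (seq x m) (seq x n)) ⟩
      ℚ.∣ q ℚ.* d ∣
        ≡⟨ ℚ.∣p*q∣≡∣p∣*∣q∣ q d ⟩
      ℚ.∣ q ∣ ℚ.* ℚ.∣ d ∣
        ≤⟨ ℚ.*-monoʳ-≤-nonNeg ℚ.∣ d ∣ {{ℚ.∣-∣-nonNeg d}} ∣q∣≤b ⟩
      b ℚ.* ℚ.∣ d ∣
        <⟨ ℚ.*-monoʳ-<-pos b (p m n N≤m N≤n) ⟩
      b ℚ.* (ℚ.1/ b ℚ.* ε)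
        ≡⟨ sym (ℚ.*-assoc b (ℚ.1/ b) ε) ⟩
      (b ℚ.* ℚ.1/ b) ℚ.* ε
        ≡⟨ cong (ℚ._* ε) (ℚ.*-inverseʳ b) ⟩
      1ℚ ℚ.* ε
        ≡⟨ ℚ.*-identityˡ ε ⟩
      ε ∎

∣_∣ʳ : ℝ → ℝ
∣ x ∣ʳ = mkℝ (λ n → ℚ.∣ seq x n ∣) λ ε 0<ε →
  let (N , p) = cauchy x ε 0<ε
  in N , λ m n N≤m N≤n →
    ℚ.≤-<-trans (∣∣a∣-∣b∣∣≤∣a-b∣ (seq x m) (seq x n)) (p m n N≤m N≤n)

ℝ² : Set
ℝ² = ℝ × ℝ

------------------------------------------------------------------------
-- The integer lattice

ℤ² : Set
ℤ² = ℤ × ℤ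

infixl 6 _⊕_
infixr 7 _⊛_

_⊕_ : ℤ² → ℤ² → ℤ²
(a , b) ⊕ (c , d) = a ℤ.+ c , b ℤ.+ d

_⊛_ : ℤ → ℤ² → ℤ²
k ⊛ (a , b) = k ℤ.* a , k ℤ.* b

𝟎 : ℤ²
𝟎 = 0ℤ , 0ℤ

⟨_,_⟩ : ℝ² → ℤ² → ℝ
⟨ (x , y) , (a , b) ⟩ = (a ℚ./ 1) · x + (b ℚ./ 1) · y

𝓔 : Pred ℤ² 0ℓ
𝓔 v = ∃[ w ] v ≡ (+ 2) ⊛ w

𝓞 : Pred ℤ² 0ℓ
𝓞 v = ∃[ w ] v ≡ (+ 2) ⊛ w ⊕ (1ℤ , 1ℤ)

LinearlyIndependent : ℤ² → ℤ² → Set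
LinearlyIndependent v w =
  ∀ a b → a ⊛ v ⊕ b ⊛ w ≡ 𝟎 → a ≡ 0ℤ × b ≡ 0ℤ

record ValidLattice : Set where
  field
    v₀ v₁       : ℤ²
    v₀∈𝓔⊎𝓞      : v₀ ∈ 𝓔 ⊎ v₀ ∈ 𝓞
    v₁∈𝓔⊎𝓞      : v₁ ∈ 𝓔 ⊎ v₁ ∈ 𝓞
    independent : LinearlyIndependent v₀ v₁

-- The subgroup generated by v₀ and v₁.
⟦_⟧ : ValidLattice → Pred ℤ² 0ℓ
⟦ L ⟧ v = ∃₂ λ a b → v ≡ a ⊛ v₀ ⊕ b ⊛ v₁
  where open ValidLattice L

------------------------------------------------------------------------
-- Domino tilings of the plane

-- (i , j) stands for the unit square [i,i+1] × [j,j+1].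
Square : Set
Square = ℤ²

Black : Pred Square 0ℓ
Black (i , j) = + 2 ∣ i ℤ.+ j

-- A domino is given by its lower-left square and its direction.
data Domino : Set where
  horizontal vertical : Square → Domino

squares : Domino → Square × Square
squares (horizontal s) = s , s ⊕ (1ℤ , 0ℤ)
squares (vertical   s) = s , s ⊕ (0ℤ , 1ℤ)

infix 4 _∈ᵈ_

_∈ᵈ_ : Square → Domino → Set
s ∈ᵈ d = s ≡ proj₁ (squares d) ⊎ s ≡ proj₂ (squares d)

-- Two dominoes have disjoint interiors iff they share no unit square, and
-- dominoes cover the plane iff they cover every unit square.
record IsTiling (T : Pred Domino 0ℓ) : Set where
  field
    disjoint : ∀ {d d′ s} → d ∈ T → d′ ∈ T → s ∈ᵈ d → s ∈ᵈ d′ → d ≡ d′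
    covering : ∀ s → ∃[ d ] (d ∈ T × s ∈ᵈ d)

shift : ℤ² → Domino → Domino
shift v (horizontal s) = horizontal (s ⊕ v)
shift v (vertical   s) = vertical   (s ⊕ v)

Periodic : ValidLattice → Pred Domino 0ℓ → Set
Periodic L T = ∀ v → v ∈ ⟦ L ⟧ → ∀ d → d ∈ T → shift v d ∈ T

record TorusTiling (L : ValidLattice) : Set₁ where
  field
    dominoes : Pred Domino 0ℓ
    isTiling : IsTiling dominoes
    periodic : Periodic L dominoes

------------------------------------------------------------------------
-- Height functions

data Side : Set where
  left top right bottom : Side

-- Each side of a square, oriented from tail to head so that the boundary
-- is traversed clockwise.  Every edge of ℤ² is a side of exactly one black
-- square, so the oriented edges are the pairs (black square, side).
tail head : Square → Side → ℤ²
tail s left   = s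
tail s top    = s ⊕ (0ℤ , 1ℤ)
tail s right  = s ⊕ (1ℤ , 1ℤ)
tail s bottom = s ⊕ (1ℤ , 0ℤ)
head s left   = s ⊕ (0ℤ , 1ℤ)
head s top    = s ⊕ (1ℤ , 1ℤ)
head s right  = s ⊕ (1ℤ , 0ℤ)
head s bottom = s

-- The square on the other side of the edge.
neighbour : Square → Side → Square
neighbour s left   = s ⊕ (ℤ.-1ℤ , 0ℤ)
neighbour s top    = s ⊕ (0ℤ , 1ℤ)
neighbour s right  = s ⊕ (1ℤ , 0ℤ)
neighbour s bottom = s ⊕ (0ℤ , ℤ.-1ℤ)

CrossesDomino : Pred Domino 0ℓ → Square → Side → Set
CrossesDomino T s e = ∃[ d ] (d ∈ T × s ∈ᵈ d × neighbour s e ∈ᵈ d)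

record IsHeightFunction (T : Pred Domino 0ℓ) (h : ℤ² → ℤ) : Set where
  field
    origin    : h 𝟎 ≡ 0ℤ
    uncrossed : ∀ s e → s ∈ Black → ¬ CrossesDomino T s e →
                h (head s e) ≡ h (tail s e) ℤ.+ 1ℤ
    crossed   : ∀ s e → s ∈ Black → CrossesDomino T s e →
                h (head s e) ≡ h (tail s e) ℤ.- + 3

------------------------------------------------------------------------
-- Flux

-- φ is the flux of a tiling of the torus with height function h.
IsFlux : ValidLattice → (ℤ² → ℤ) → ℝ² → Set
IsFlux L h φ = ∀ v → v ∈ ⟦ L ⟧ → ∀ u →
  (+ 4 ℚ./ 1) · ⟨ φ , v ⟩ ≈ fromℤ (h (u ⊕ v) ℤ.- h u)

-- The height function of a tiling and the flux of a torus tiling are unique.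
𝓕 : ValidLattice → Pred ℝ² (Level.suc 0ℓ)
𝓕 L φ = Σ (TorusTiling L) λ t → ∃[ h ]
  (IsHeightFunction (TorusTiling.dominoes t) h × IsFlux L h φ)

infix 9 _♯

_♯ : ValidLattice → Pred ℝ² 0ℓ
(L ♯) φ = Condition v₀ × Condition v₁
  where
  open ValidLattice L
  Condition : ℤ² → Set
  Condition v =
    (v ∈ 𝓔 → ∃[ k ] ⟨ φ , v ⟩ ≈ fromℤ k) ×
    (v ∈ 𝓞 → ∃[ k ] ⟨ φ , v ⟩ ≈ fromℤ k + fromℚ ½)

Q : Pred ℝ² 0ℓ
Q (x , y) = ∣ x ∣ʳ + ∣ y ∣ʳ ≤ fromℚ ½

{-# OPTIONS --safe #-}
module Submission where

-- A black square has at most one crossed side, so the height changes by ±2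
-- along each of its diagonals.  Hence |h(u + v) − h(u)| ≤ 2n for
-- v = (n , ±n) ∈ L, which bounds the flux φ by |x ± y| ≤ 1/2, that is, φ ∈ Q;
-- the residues of h modulo 4 do not depend on the tiling and give φ ∈ L♯.
--
-- Conversely, a φ ∈ L♯ is rational.  Rounding 4⟨φ,u⟩ down to the residue class
-- prescribed modulo 4 at the even points u gives values whose diagonal
-- differences are ±2 precisely because φ ∈ Q, and these extend to the odd
-- points by a local formula.  The dominoes across the edges where the resulting
-- L-quasiperiodic function jumps by 3 form the required tiling: the increments
-- around a unit square are 1 or −3 and add up to 0, so exactly one is −3.

-- At an even point `(i , j)` every height function is congruent to `2i` modulo 4, and for `v` in
-- `𝓔` or in `𝓞` alike the condition of `L ♯` says that `4⟨φ,v⟩` is congruent to twice the first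
-- coordinate of `v`. So translation by `v ∈ L` respects the prescribed residues and shifts the
-- rounded values by exactly `4⟨φ,v⟩`. Rounding needs a floor, which is not computable for a Cauchy
-- real. The conditions on the two basis vectors determine `φ` by Cramer's rule with denominator
-- `4 det²`, so the floor becomes an integer division. The value at an odd point is nearly forced.
-- Vertical edges are oriented out of even points, and the two vertical neighbours have heights
-- differing by 0 or 4; if they differ, only the lower height plus 1 gives increments 1 and -3.
-- Horizontal edges are oriented out of odd points, and it is there that the inequality defining `Q`
-- is used at full strength.

open import Defs
open import Relation.Unary using (Pred; _∈_; _≐_; _∩_)
open import Data.Bool.Base using (Bool; true; false)
open import Data.Empty using (⊥; ⊥-elim)
open import Data.Integer.Base as ℤ using (ℤ; +_; -[1+_]; 0ℤ; 1ℤ; -1ℤ; ∣_∣; +≤+)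
open import Data.Integer.DivMod using (_/ℕ_; _%ℕ_; n%ℕd<d; a≡a%ℕn+[a/ℕn]*n; [n/ℕd]*d≤n; n<s[n/ℕd]*d)
import Data.Integer.Divisibility.Signed as Signed
import Data.Integer.Properties as ℤ
open import Data.Integer.Tactic.RingSolver using (solve-∀)
open import Data.Nat.Base as ℕ using (ℕ; zero; suc)
import Data.Nat.Properties as ℕ
open import Data.Product.Base using (∃-syntax; _×_; _,_; map₂; proj₁; proj₂)
open import Data.Sum.Base using (_⊎_; inj₁; inj₂)
open import Function.Base using (_∘_)
open import Relation.Binary.PropositionalEquality
  using (_≡_; _≢_; refl; sym; trans; cong; cong₂; subst; subst₂; module ≡-Reasoning)
open import Relation.Nullary using (¬_; yes; no)
open import Level using (0ℓ)
import Data.Rational.Base as ℚ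
import Data.Rational.Properties as ℚ
open import Data.Rational.Base using (ℚ; 0ℚ; 1ℚ; ½)
import Data.Rational.Unnormalised.Base as ℚᵘ
import Data.Rational.Unnormalised.Properties as ℚᵘ
open import Data.Rational.Solver using (module +-*-Solver)
open +-*-Solver using (_:+_; _:*_; :-_; _:-_; _:=_; con) renaming (solve to solveℚ)

-- Squares and dominoes

⊕-assoc : ∀ u v w → u ⊕ v ⊕ w ≡ u ⊕ (v ⊕ w)
⊕-assoc (a , b) (c , d) (e , f) = cong₂ _,_ (ℤ.+-assoc a c e) (ℤ.+-assoc b d f)

⊕-comm : ∀ u v → u ⊕ v ≡ v ⊕ u
⊕-comm (a , b) (c , d) = cong₂ _,_ (ℤ.+-comm a c) (ℤ.+-comm b d)

⊕-identityʳ : ∀ u → u ⊕ 𝟎 ≡ u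
⊕-identityʳ (a , b) = cong₂ _,_ (ℤ.+-identityʳ a) (ℤ.+-identityʳ b)

⊕-identityˡ : ∀ u → 𝟎 ⊕ u ≡ u
⊕-identityˡ (a , b) = cong₂ _,_ (ℤ.+-identityˡ a) (ℤ.+-identityˡ b)

⊕-swap : ∀ u v w → u ⊕ v ⊕ w ≡ u ⊕ w ⊕ v
⊕-swap u v w =
  trans (⊕-assoc u v w) (trans (cong (u ⊕_) (⊕-comm v w)) (sym (⊕-assoc u w v)))

⊕-cancelˡ : ∀ u v w → u ⊕ v ≡ u ⊕ w → v ≡ w
⊕-cancelˡ (a , b) (c , d) (e , f) eq =
  cong₂ _,_ (cancel a c e (cong proj₁ eq)) (cancel b d f (cong proj₂ eq))
  where
  cancel : ∀ x y z → x ℤ.+ y ≡ x ℤ.+ z → y ≡ z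
  cancel x y z eq = trans (lem x y) (trans (cong (ℤ._- x) eq) (sym (lem x z)))
    where
    lem : ∀ x y → y ≡ (x ℤ.+ y) ℤ.- x
    lem = solve-∀

⊕≢self : ∀ u v → v ≢ 𝟎 → u ⊕ v ≢ u
⊕≢self u v v≢0 eq = v≢0 (⊕-cancelˡ u v 𝟎 (trans eq (sym (⊕-identityʳ u))))

offset : Side → ℤ²
offset left   = -1ℤ , 0ℤ
offset top    = 0ℤ , 1ℤ
offset right  = 1ℤ , 0ℤ
offset bottom = 0ℤ , -1ℤ

neighbour≡ : ∀ s e → neighbour s e ≡ s ⊕ offset e
neighbour≡ s left   = refl
neighbour≡ s top    = refl
neighbour≡ s right  = refl
neighbour≡ s bottom = refl

offset≢𝟎 : ∀ e → offset e ≢ 𝟎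
offset≢𝟎 left   ()
offset≢𝟎 top    ()
offset≢𝟎 right  ()
offset≢𝟎 bottom ()

offset-injective : ∀ e f → offset e ≡ offset f → e ≡ f
offset-injective left   left   _ = refl
offset-injective top    top    _ = refl
offset-injective right  right  _ = refl
offset-injective bottom bottom _ = refl
offset-injective left   top    ()
offset-injective left   right  ()
offset-injective left   bottom ()
offset-injective top    left   ()
offset-injective top    right  ()
offset-injective top    bottom ()
offset-injective right  left   ()
offset-injective right  top    ()
offset-injective right  bottom ()
offset-injective bottom left   ()
offset-injective bottom top    ()
offset-injective bottom right  ()

neighbour-injective : ∀ s e f → neighbour s e ≡ neighbour s f → e ≡ f
neighbour-injective s e f eq = offset-injective e f
  (⊕-cancelˡ s _ _ (trans (sym (neighbour≡ s e)) (trans eq (neighbour≡ s f))))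

neighbour≢self : ∀ s e → neighbour s e ≢ s
neighbour≢self s e eq =
  ⊕≢self s (offset e) (offset≢𝟎 e) (trans (sym (neighbour≡ s e)) eq)

-- Naming a domino by one of its squares and the side it leaves through turns uniqueness of the
-- domino at a square into equality of two sides.
across : Square → Side → Domino
across s left   = horizontal (s ⊕ (-1ℤ , 0ℤ))
across s top    = vertical s
across s right  = horizontal s
across s bottom = vertical (s ⊕ (0ℤ , -1ℤ))

self-left : ∀ s → s ≡ s ⊕ (-1ℤ , 0ℤ) ⊕ (1ℤ , 0ℤ)
self-left s = trans (sym (⊕-identityʳ s)) (sym (⊕-assoc s _ _))

self-bottom : ∀ s → s ≡ s ⊕ (0ℤ , -1ℤ) ⊕ (0ℤ , 1ℤ)
self-bottom s = trans (sym (⊕-identityʳ s)) (sym (⊕-assoc s _ _))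

self∈across : ∀ s e → s ∈ᵈ across s e
self∈across s left   = inj₂ (self-left s)
self∈across s top    = inj₁ refl
self∈across s right  = inj₁ refl
self∈across s bottom = inj₂ (self-bottom s)

neighbour∈across : ∀ s e → neighbour s e ∈ᵈ across s e
neighbour∈across s left   = inj₁ refl
neighbour∈across s top    = inj₂ refl
neighbour∈across s right  = inj₂ refl
neighbour∈across s bottom = inj₁ refl

∈across⇒ : ∀ s e t → t ∈ᵈ across s e → t ≡ s ⊎ t ≡ neighbour s e
∈across⇒ s left   t (inj₁ eq) = inj₂ eq
∈across⇒ s left   t (inj₂ eq) = inj₁ (trans eq (sym (self-left s)))
∈across⇒ s top    t (inj₁ eq) = inj₁ eq
∈across⇒ s top    t (inj₂ eq) = inj₂ eq
∈across⇒ s right  t (inj₁ eq) = inj₁ eq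
∈across⇒ s right  t (inj₂ eq) = inj₂ eq
∈across⇒ s bottom t (inj₁ eq) = inj₂ eq
∈across⇒ s bottom t (inj₂ eq) = inj₁ (trans eq (sym (self-bottom s)))

∈⇒across : ∀ s d → s ∈ᵈ d → ∃[ e ] d ≡ across s e
∈⇒across s (horizontal _) (inj₁ refl) = right , refl
∈⇒across s (horizontal t) (inj₂ refl) = left , cong horizontal
  (sym (trans (⊕-assoc t _ _) (⊕-identityʳ t)))
∈⇒across s (vertical _) (inj₁ refl) = top , refl
∈⇒across s (vertical t) (inj₂ refl) = bottom , cong vertical
  (sym (trans (⊕-assoc t _ _) (⊕-identityʳ t)))

across-injective : ∀ s e f → across s e ≡ across s f → e ≡ f
across-injective s e f eq
  with ∈across⇒ s f (neighbour s e) (subst (neighbour s e ∈ᵈ_) eq (neighbour∈across s e))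
... | inj₁ eq′ = ⊥-elim (neighbour≢self s e eq′)
... | inj₂ eq′ = neighbour-injective s e f eq′

-- This reduces `CrossesDomino`, an existential over all dominoes, to membership of a single domino.
both∈⇒across : ∀ s e d → s ∈ᵈ d → neighbour s e ∈ᵈ d → d ≡ across s e
both∈⇒across s e d s∈d n∈d with ∈⇒across s d s∈d
... | f , refl with ∈across⇒ s f (neighbour s e) n∈d
...   | inj₁ eq = ⊥-elim (neighbour≢self s e eq)
...   | inj₂ eq = cong (across s) (sym (neighbour-injective s e f eq))

module _ {T : Pred Domino 0ℓ} where

  across⇒crosses : ∀ s e → T (across s e) → CrossesDomino T s e
  across⇒crosses s e d∈T = across s e , d∈T , self∈across s e , neighbour∈across s e

  crosses⇒across : ∀ s e → CrossesDomino T s e → T (across s e)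
  crosses⇒across s e (d , d∈T , s∈d , n∈d) = subst T (both∈⇒across s e d s∈d n∈d) d∈T

-- Increments of a height function along an oriented edge

increment : Bool → ℤ
increment false = 1ℤ
increment true  = ℤ.- (+ 3)

same : Side → Side → Bool
same left   left   = true
same top    top    = true
same right  right  = true
same bottom bottom = true
same _      _      = false

same-refl : ∀ e → same e e ≡ true
same-refl left   = refl
same-refl top    = refl
same-refl right  = refl
same-refl bottom = refl

same⇒≡ : ∀ e f → same e f ≡ true → e ≡ f
same⇒≡ left   left   _ = refl
same⇒≡ top    top    _ = refl
same⇒≡ right  right  _ = refl
same⇒≡ bottom bottom _ = refl
same⇒≡ left   top    ()
same⇒≡ left   right  ()
same⇒≡ left   bottom ()
same⇒≡ top    left   ()
same⇒≡ top    right  ()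
same⇒≡ top    bottom ()
same⇒≡ right  left   ()
same⇒≡ right  top    ()
same⇒≡ right  bottom ()
same⇒≡ bottom left   ()
same⇒≡ bottom top    ()
same⇒≡ bottom right  ()

perimeter : (Side → ℤ) → ℤ
perimeter f = f left ℤ.+ f top ℤ.+ f right ℤ.+ f bottom

-- A function on `Side` cannot be matched on, but its four values can; `bySide-η` recovers the
-- function pointwise, without extensionality.
bySide : Bool → Bool → Bool → Bool → Side → Bool
bySide a b c d left   = a
bySide a b c d top    = b
bySide a b c d right  = c
bySide a b c d bottom = d

bySide-η : ∀ (k : Side → Bool) e → bySide (k left) (k top) (k right) (k bottom) e ≡ k e
bySide-η k left   = refl
bySide-η k top    = refl
bySide-η k right  = refl
bySide-η k bottom = refl

-- With j values -3 among the four, the sum is 4 - 4j, so it vanishes only for j = 1.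
unique-jump-bySide : ∀ a b c d → increment a ℤ.+ increment b ℤ.+ increment c ℤ.+ increment d ≡ 0ℤ →
     ∃[ e₀ ] (∀ e → bySide a b c d e ≡ same e e₀)
unique-jump-bySide true false false false _ = left , λ { left → refl ; top → refl ; right → refl ; bottom → refl }
unique-jump-bySide false true false false _ = top , λ { left → refl ; top → refl ; right → refl ; bottom → refl }
unique-jump-bySide false false true false _ = right , λ { left → refl ; top → refl ; right → refl ; bottom → refl }
unique-jump-bySide false false false true _ = bottom , λ { left → refl ; top → refl ; right → refl ; bottom → refl }
unique-jump-bySide true true true true ()
unique-jump-bySide true true true false ()
unique-jump-bySide true true false true ()
unique-jump-bySide true true false false ()
unique-jump-bySide true false true true ()
unique-jump-bySide true false true false ()
unique-jump-bySide true false false true ()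
unique-jump-bySide false true true true ()
unique-jump-bySide false true true false ()
unique-jump-bySide false true false true ()
unique-jump-bySide false false true true ()
unique-jump-bySide false false false false ()

unique-jump : (k : Side → Bool) → perimeter (λ e → increment (k e)) ≡ 0ℤ → ∃[ e₀ ] (∀ e → k e ≡ same e e₀)
unique-jump k sum≡0 with unique-jump-bySide (k left) (k top) (k right) (k bottom) sum≡0
... | e₀ , p = e₀ , λ e → trans (sym (bySide-η k e)) (p e)

-- Integer division

0≤+ : ∀ {i j} → 0ℤ ℤ.≤ i → 0ℤ ℤ.≤ j → 0ℤ ℤ.≤ i ℤ.+ j
0≤+ = ℤ.+-mono-≤ {0ℤ} {_} {0ℤ}

0≤-resp : ∀ {i j} → i ≡ j → 0ℤ ℤ.≤ i → 0ℤ ℤ.≤ j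
0≤-resp = subst (0ℤ ℤ.≤_)

between-consecutive : ∀ {i j} → i ℤ.≤ j → j ℤ.≤ i ℤ.+ 1ℤ → j ≡ i ⊎ j ≡ i ℤ.+ 1ℤ
between-consecutive {i} {j} i≤j j≤i+1 with j ℤ.≟ i
... | yes eq = inj₁ eq
... | no j≢i = inj₂ (ℤ.≤-antisym j≤i+1
  (subst (ℤ._≤ j) (ℤ.+-comm 1ℤ i) (ℤ.i<j⇒suc[i]≤j (ℤ.≤∧≢⇒< i≤j (j≢i ∘ sym)))))

module _ (d : ℕ) .{{_ : ℕ.NonZero d}} where

  -- Together with `[n/ℕd]*d≤n` this is the universal property of the floor, from which monotonicity
  -- and translation follow without unfolding the division.
  /ℕ-greatest : ∀ {k x} → k ℤ.* + d ℤ.≤ x → k ℤ.≤ x /ℕ d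
  /ℕ-greatest {k} {x} k*d≤x = subst (k ℤ.≤_) (ℤ.pred-suc (x /ℕ d))
    (ℤ.i<j⇒i≤pred[j] (ℤ.*-cancelʳ-<-nonNeg {j = ℤ.suc (x /ℕ d)} (+ d) (ℤ.≤-<-trans k*d≤x (n<s[n/ℕd]*d x d))))

  /ℕ-mono : ∀ {x y} → x ℤ.≤ y → x /ℕ d ℤ.≤ y /ℕ d
  /ℕ-mono {x} x≤y = /ℕ-greatest (ℤ.≤-trans ([n/ℕd]*d≤n x d) x≤y)

  /ℕ-+*-≤ : ∀ x k → x /ℕ d ℤ.+ k ℤ.≤ (x ℤ.+ k ℤ.* + d) /ℕ d
  /ℕ-+*-≤ x k = /ℕ-greatest (subst (ℤ._≤ x ℤ.+ k ℤ.* + d)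
    (sym (ℤ.*-distribʳ-+ (+ d) (x /ℕ d) k))
    (ℤ.+-monoˡ-≤ (k ℤ.* + d) ([n/ℕd]*d≤n x d)))

  -- The upper bound is the lower bound `/ℕ-+*-≤` for the translation by `- k`.
  /ℕ-+* : ∀ x k → (x ℤ.+ k ℤ.* + d) /ℕ d ≡ x /ℕ d ℤ.+ k
  /ℕ-+* x k = ℤ.≤-antisym upper (/ℕ-+*-≤ x k)
    where
    open ℤ.≤-Reasoning
    y = x ℤ.+ k ℤ.* + d
    lem₁ : ∀ q k → q ≡ q ℤ.+ (ℤ.- k) ℤ.+ k
    lem₁ = solve-∀
    lem₂ : ∀ x k d → x ℤ.+ k ℤ.* d ℤ.+ (ℤ.- k) ℤ.* d ≡ x
    lem₂ = solve-∀
    upper : y /ℕ d ℤ.≤ x /ℕ d ℤ.+ k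
    upper = begin
      y /ℕ d                                       ≡⟨ lem₁ (y /ℕ d) k ⟩
      y /ℕ d ℤ.+ (ℤ.- k) ℤ.+ k                     ≤⟨ ℤ.+-monoˡ-≤ k (/ℕ-+*-≤ y (ℤ.- k)) ⟩
      (y ℤ.+ (ℤ.- k) ℤ.* + d) /ℕ d ℤ.+ k           ≡⟨ cong (λ z → z /ℕ d ℤ.+ k) (lem₂ x k (+ d)) ⟩
      x /ℕ d ℤ.+ k                                 ∎

  /ℕ-step : ∀ x δ → 0ℤ ℤ.≤ δ → 0ℤ ℤ.≤ + d ℤ.- δ →
            (x ℤ.+ δ) /ℕ d ≡ x /ℕ d ⊎ (x ℤ.+ δ) /ℕ d ≡ x /ℕ d ℤ.+ 1ℤ
  /ℕ-step x δ 0≤δ 0≤d-δ = between-consecutive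
    (/ℕ-mono (subst (ℤ._≤ x ℤ.+ δ) (ℤ.+-identityʳ x) (ℤ.+-monoʳ-≤ x 0≤δ)))
    (ℤ.≤-trans
      (/ℕ-mono (ℤ.+-monoʳ-≤ x (subst (δ ℤ.≤_) (sym (ℤ.*-identityˡ (+ d))) (ℤ.0≤i-j⇒j≤i 0≤d-δ))))
      (ℤ.≤-reflexive (/ℕ-+* x 1ℤ)))

0/ℕ : ∀ d .{{_ : ℕ.NonZero d}} → 0ℤ /ℕ d ≡ 0ℤ
0/ℕ (suc d) = refl

-- Parity

-- The representative `r` may be any integer: giving an odd vector `r = -1ℤ` makes its sum with an
-- odd point land in `Even` by computation.
record Class (r : ℤ) (u : ℤ²) : Set where
  constructor class
  field
    half     : ℤ
    sum≡r+2k : proj₁ u ℤ.+ proj₂ u ≡ r ℤ.+ half ℤ.* + 2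

Even Odd : Pred ℤ² 0ℓ
Even = Class 0ℤ
Odd  = Class 1ℤ

even⊎odd : ∀ u → Even u ⊎ Odd u
even⊎odd (i , j) with (i ℤ.+ j) %ℕ 2 | n%ℕd<d (i ℤ.+ j) 2 | a≡a%ℕn+[a/ℕn]*n (i ℤ.+ j) 2
... | 0 | _ | eq = inj₁ (class ((i ℤ.+ j) /ℕ 2) eq)
... | 1 | _ | eq = inj₂ (class ((i ℤ.+ j) /ℕ 2) eq)
... | suc (suc _) | ℕ.s≤s (ℕ.s≤s ()) | _

black⇒even : ∀ {s} → s ∈ Black → Even s
black⇒even {s} 2∣ with Signed.∣ᵤ⇒∣ {+ 2} {proj₁ s ℤ.+ proj₂ s} 2∣
... | Signed.divides k eq = class k (trans eq (sym (ℤ.+-identityˡ (k ℤ.* + 2))))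

even⇒black : ∀ s → Even s → s ∈ Black
even⇒black s (class k eq) = Signed.∣⇒∣ᵤ {+ 2} {proj₁ s ℤ.+ proj₂ s}
  (Signed.divides k (trans eq (ℤ.+-identityˡ (k ℤ.* + 2))))

class-⊕ : ∀ {r u r′ v} → Class r u → Class r′ v → Class (r ℤ.+ r′) (u ⊕ v)
class-⊕ {r} {a , b} {r′} {c , d} (class k p) (class m q) = class (k ℤ.+ m) (begin
  (a ℤ.+ c) ℤ.+ (b ℤ.+ d)                              ≡⟨ interchange a c b d ⟩
  (a ℤ.+ b) ℤ.+ (c ℤ.+ d)                              ≡⟨ cong₂ ℤ._+_ p q ⟩
  (r ℤ.+ k ℤ.* + 2) ℤ.+ (r′ ℤ.+ m ℤ.* + 2)             ≡⟨ collect r k r′ m ⟩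
  r ℤ.+ r′ ℤ.+ (k ℤ.+ m) ℤ.* + 2                       ∎)
  where
  open ≡-Reasoning
  interchange : ∀ a c b d → (a ℤ.+ c) ℤ.+ (b ℤ.+ d) ≡ (a ℤ.+ b) ℤ.+ (c ℤ.+ d)
  interchange = solve-∀
  collect : ∀ r k r′ m → (r ℤ.+ k ℤ.* + 2) ℤ.+ (r′ ℤ.+ m ℤ.* + 2) ≡ r ℤ.+ r′ ℤ.+ (k ℤ.+ m) ℤ.* + 2
  collect = solve-∀

even-⊛ : ∀ k {v} → Even v → Even (k ⊛ v)
even-⊛ k {a , b} (class m eq) = class (k ℤ.* m)
  (trans (sym (ℤ.*-distribˡ-+ k a b)) (trans (cong (ℤ._*_ k) eq) (lem k m)))
  where
  lem : ∀ k m → k ℤ.* (0ℤ ℤ.+ m ℤ.* + 2) ≡ 0ℤ ℤ.+ k ℤ.* m ℤ.* + 2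
  lem = solve-∀

valid⇒even : ∀ {v} → v ∈ 𝓔 ⊎ v ∈ 𝓞 → Even v
valid⇒even (inj₁ ((a , b) , refl)) = class (a ℤ.+ b) (lem a b)
  where
  lem : ∀ a b → + 2 ℤ.* a ℤ.+ + 2 ℤ.* b ≡ 0ℤ ℤ.+ (a ℤ.+ b) ℤ.* + 2
  lem = solve-∀
valid⇒even (inj₂ ((a , b) , refl)) = class (a ℤ.+ b ℤ.+ 1ℤ) (lem a b)
  where
  lem : ∀ a b → + 2 ℤ.* a ℤ.+ 1ℤ ℤ.+ (+ 2 ℤ.* b ℤ.+ 1ℤ) ≡ 0ℤ ℤ.+ (a ℤ.+ b ℤ.+ 1ℤ) ℤ.* + 2
  lem = solve-∀

-- An integer, 0 or 1, rather than a case distinction, so that `height` is one formula for all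
-- points.
parity : ℤ² → ℤ
parity (i , j) = (i ℤ.+ j) ℤ.- (i ℤ.+ j) /ℕ 2 ℤ.* + 2

class⇒parity : ∀ {r u} → Class r u → parity u ≡ r ℤ.- r /ℕ 2 ℤ.* + 2
class⇒parity {r} {u} (class k eq) = begin
  parity u                                                        ≡⟨ cong (λ z → z ℤ.- z /ℕ 2 ℤ.* + 2) eq ⟩
  (r ℤ.+ k ℤ.* + 2) ℤ.- (r ℤ.+ k ℤ.* + 2) /ℕ 2 ℤ.* + 2            ≡⟨ cong (λ q → (r ℤ.+ k ℤ.* + 2) ℤ.- q ℤ.* + 2) (/ℕ-+* 2 r k) ⟩
  (r ℤ.+ k ℤ.* + 2) ℤ.- (r /ℕ 2 ℤ.+ k) ℤ.* + 2                    ≡⟨ cancel r k (r /ℕ 2) ⟩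
  r ℤ.- r /ℕ 2 ℤ.* + 2                                            ∎
  where
  open ≡-Reasoning
  cancel : ∀ r k q → (r ℤ.+ k ℤ.* + 2) ℤ.- (q ℤ.+ k) ℤ.* + 2 ≡ r ℤ.- q ℤ.* + 2
  cancel = solve-∀

parity-⊕-even : ∀ u {v} → Even v → parity (u ⊕ v) ≡ parity u
parity-⊕-even u v-even with even⊎odd u
... | inj₁ u-even = trans (class⇒parity (class-⊕ u-even v-even)) (sym (class⇒parity u-even))
... | inj₂ u-odd  = trans (class⇒parity (class-⊕ u-odd v-even)) (sym (class⇒parity u-odd))

0≤∣i∣-i : ∀ i → 0ℤ ℤ.≤ + ∣ i ∣ ℤ.- i
0≤∣i∣-i (+ n)    = ℤ.≤-reflexive (sym (ℤ.+-inverseʳ (+ n)))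
0≤∣i∣-i -[1+ n ] = +≤+ ℕ.z≤n

0≤∣i∣+i : ∀ i → 0ℤ ℤ.≤ + ∣ i ∣ ℤ.+ i
0≤∣i∣+i (+ n)    = +≤+ ℕ.z≤n
0≤∣i∣+i -[1+ n ] = ℤ.≤-reflexive (sym (ℤ.+-inverseˡ -[1+ n ]))

-- Here 4φ = (P / n , R / n).  The height of an even point u = (i , j) is the
-- largest integer ≤ 4⟨φ,u⟩ congruent to 2i modulo 4; at an odd point it is one
-- more than the smaller of the heights of the two vertical neighbours.
module Rounding (n : ℕ) .{{_ : ℕ.NonZero n}} (P R : ℤ)
                (bound : ∣ P ∣ ℕ.+ ∣ R ∣ ℕ.≤ 2 ℕ.* n) where

  M : ℕ
  M = 4 ℕ.* n

  instance
    M≢0 : ℕ.NonZero M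
    M≢0 = ℕ.m*n≢0 4 n

  A : ℤ
  A = + ∣ R ∣

  -- This is `n` times `4⟨φ,u⟩ - 2i`. Its quotient by `M = 4n` counts the steps of 4 from the base
  -- value `2i`.
  linear : ℤ² → ℤ
  linear (i , j) = (P ℤ.- + 2 ℤ.* + n) ℤ.* i ℤ.+ R ℤ.* j

  linear-⊕ : ∀ u v → linear (u ⊕ v) ≡ linear u ℤ.+ linear v
  linear-⊕ (i , j) (a , b) = lem (P ℤ.- + 2 ℤ.* + n) R i j a b
    where
    lem : ∀ p r i j a b → p ℤ.* (i ℤ.+ a) ℤ.+ r ℤ.* (j ℤ.+ b) ≡
                          p ℤ.* i ℤ.+ r ℤ.* j ℤ.+ (p ℤ.* a ℤ.+ r ℤ.* b)
    lem = solve-∀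

  -- At the vertical neighbours `linear` takes the values `linear u ± R`, so subtracting `A` before
  -- dividing selects the smaller height; `parity u` switches this on at odd points.
  height : ℤ² → ℤ
  height u = + 2 ℤ.* proj₁ u ℤ.+ parity u ℤ.+ + 4 ℤ.* ((linear u ℤ.- parity u ℤ.* A) /ℕ M)

  height-class : ∀ {u ε} → parity u ≡ ε →
    height u ≡ + 2 ℤ.* proj₁ u ℤ.+ ε ℤ.+ + 4 ℤ.* ((linear u ℤ.- ε ℤ.* A) /ℕ M)
  height-class {u} = cong λ ε → + 2 ℤ.* proj₁ u ℤ.+ ε ℤ.+ + 4 ℤ.* ((linear u ℤ.- ε ℤ.* A) /ℕ M)

  height-even : ∀ {u} → Even u → height u ≡ + 2 ℤ.* proj₁ u ℤ.+ + 4 ℤ.* (linear u /ℕ M)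
  height-even {u} u-even = trans (height-class {u} (class⇒parity u-even))
    (cong₂ ℤ._+_ (ℤ.+-identityʳ (+ 2 ℤ.* proj₁ u))
                 (cong (λ x → + 4 ℤ.* (x /ℕ M)) (ℤ.+-identityʳ (linear u))))

  height-odd : ∀ {u} → Odd u →
    height u ≡ + 2 ℤ.* proj₁ u ℤ.+ 1ℤ ℤ.+ + 4 ℤ.* ((linear u ℤ.- A) /ℕ M)
  height-odd {u} u-odd = trans (height-class {u} (class⇒parity u-odd))
    (cong (λ a → + 2 ℤ.* proj₁ u ℤ.+ 1ℤ ℤ.+ + 4 ℤ.* ((linear u ℤ.- a) /ℕ M)) (ℤ.*-identityˡ A))

  -- An even `v` keeps the parity, and a multiple of `M` passes through the floor. The resulting
  -- shift is `4⟨φ,v⟩`.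
  height-⊕ : ∀ v k → Even v → linear v ≡ k ℤ.* + M →
    ∀ u → height (u ⊕ v) ≡ height u ℤ.+ (+ 2 ℤ.* proj₁ v ℤ.+ + 4 ℤ.* k)
  height-⊕ v k v-even lv≡ u = begin
    height (u ⊕ v)
      ≡⟨ height-class {u ⊕ v} (parity-⊕-even u v-even) ⟩
    + 2 ℤ.* (proj₁ u ℤ.+ proj₁ v) ℤ.+ ε ℤ.+ + 4 ℤ.* ((linear (u ⊕ v) ℤ.- ε ℤ.* A) /ℕ M)
      ≡⟨ cong (λ x → + 2 ℤ.* (proj₁ u ℤ.+ proj₁ v) ℤ.+ ε ℤ.+ + 4 ℤ.* (x /ℕ M)) shifted ⟩
    + 2 ℤ.* (proj₁ u ℤ.+ proj₁ v) ℤ.+ ε ℤ.+ + 4 ℤ.* (((linear u ℤ.- ε ℤ.* A) ℤ.+ k ℤ.* + M) /ℕ M)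
      ≡⟨ cong (λ q → + 2 ℤ.* (proj₁ u ℤ.+ proj₁ v) ℤ.+ ε ℤ.+ + 4 ℤ.* q) (/ℕ-+* M (linear u ℤ.- ε ℤ.* A) k) ⟩
    + 2 ℤ.* (proj₁ u ℤ.+ proj₁ v) ℤ.+ ε ℤ.+ + 4 ℤ.* ((linear u ℤ.- ε ℤ.* A) /ℕ M ℤ.+ k)
      ≡⟨ lem₂ (proj₁ u) (proj₁ v) ε ((linear u ℤ.- ε ℤ.* A) /ℕ M) k ⟩
    height u ℤ.+ (+ 2 ℤ.* proj₁ v ℤ.+ + 4 ℤ.* k) ∎
    where
    open ≡-Reasoning
    ε = parity u
    lem₁ : ∀ a b c → a ℤ.+ b ℤ.- c ≡ (a ℤ.- c) ℤ.+ b
    lem₁ = solve-∀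
    lem₂ : ∀ i a e q k → + 2 ℤ.* (i ℤ.+ a) ℤ.+ e ℤ.+ + 4 ℤ.* (q ℤ.+ k) ≡
                         + 2 ℤ.* i ℤ.+ e ℤ.+ + 4 ℤ.* q ℤ.+ (+ 2 ℤ.* a ℤ.+ + 4 ℤ.* k)
    lem₂ = solve-∀
    shifted : linear (u ⊕ v) ℤ.- ε ℤ.* A ≡ (linear u ℤ.- ε ℤ.* A) ℤ.+ k ℤ.* + M
    shifted = begin
      linear (u ⊕ v) ℤ.- ε ℤ.* A               ≡⟨ cong (ℤ._- ε ℤ.* A) (linear-⊕ u v) ⟩
      linear u ℤ.+ linear v ℤ.- ε ℤ.* A        ≡⟨ lem₁ (linear u) (linear v) (ε ℤ.* A) ⟩
      (linear u ℤ.- ε ℤ.* A) ℤ.+ linear v      ≡⟨ cong (ℤ._+_ (linear u ℤ.- ε ℤ.* A)) lv≡ ⟩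
      (linear u ℤ.- ε ℤ.* A) ℤ.+ k ℤ.* + M     ∎

  height-origin : height 𝟎 ≡ 0ℤ
  height-origin = trans (height-even {𝟎} (class 0ℤ refl))
    (trans (cong (λ x → 0ℤ ℤ.+ + 4 ℤ.* (x /ℕ M)) linear-𝟎) (cong (λ q → 0ℤ ℤ.+ + 4 ℤ.* q) (0/ℕ M)))
    where
    linear-𝟎 : linear 𝟎 ≡ 0ℤ
    linear-𝟎 = cong₂ ℤ._+_ (ℤ.*-zeroʳ (P ℤ.- + 2 ℤ.* + n)) (ℤ.*-zeroʳ R)

  private
    B N : ℤ
    B = + ∣ P ∣
    N = + 2 ℤ.* + n

    +M≡ : + M ≡ N ℤ.+ N
    +M≡ = trans (ℤ.pos-* 4 n) (lem (+ n))
      where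
      lem : ∀ n → + 4 ℤ.* n ≡ + 2 ℤ.* n ℤ.+ + 2 ℤ.* n
      lem = solve-∀

    0≤A : 0ℤ ℤ.≤ A
    0≤A = +≤+ ℕ.z≤n

    0≤N-B-A : 0ℤ ℤ.≤ N ℤ.- B ℤ.- A
    0≤N-B-A = 0≤-resp lem (ℤ.i≤j⇒0≤j-i (+≤+ bound))
      where
      lem : + (2 ℕ.* n) ℤ.- + (∣ P ∣ ℕ.+ ∣ R ∣) ≡ N ℤ.- B ℤ.- A
      lem = trans (cong₂ ℤ._-_ (ℤ.pos-* 2 n) (ℤ.pos-+ ∣ P ∣ ∣ R ∣)) (lem′ N B A)
        where
        lem′ : ∀ a b c → a ℤ.- (b ℤ.+ c) ≡ a ℤ.- b ℤ.- c
        lem′ = solve-∀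

    0≤N-P-A : 0ℤ ℤ.≤ N ℤ.- P ℤ.- A
    0≤N-P-A = 0≤-resp (lem N B A P) (0≤+ 0≤N-B-A (0≤∣i∣-i P))
      where
      lem : ∀ n b a p → n ℤ.- b ℤ.- a ℤ.+ (b ℤ.- p) ≡ n ℤ.- p ℤ.- a
      lem = solve-∀

    0≤N+P-A : 0ℤ ℤ.≤ N ℤ.+ P ℤ.- A
    0≤N+P-A = 0≤-resp (lem N B A P) (0≤+ 0≤N-B-A (0≤∣i∣+i P))
      where
      lem : ∀ n b a p → n ℤ.- b ℤ.- a ℤ.+ (b ℤ.+ p) ≡ n ℤ.+ p ℤ.- a
      lem = solve-∀

    0≤M- : ∀ {i j} → N ℤ.+ N ℤ.- i ≡ j → 0ℤ ℤ.≤ j → 0ℤ ℤ.≤ + M ℤ.- i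
    0≤M- {i} eq 0≤j = 0≤-resp (sym (trans (cong (ℤ._- i) +M≡) eq)) 0≤j

    round-step : ∀ x y δ → y ≡ x ℤ.+ δ → 0ℤ ℤ.≤ δ → 0ℤ ℤ.≤ + M ℤ.- δ →
                 y /ℕ M ≡ x /ℕ M ⊎ y /ℕ M ≡ x /ℕ M ℤ.+ 1ℤ
    round-step x _ δ refl = /ℕ-step M x δ

  -- Increments of the rounded height along oriented edges

  Step : ℤ² → ℤ² → Set
  Step u w = ∃[ k ] height w ℤ.- height u ≡ increment k

  carry : ∀ x {y} → y ≡ x ⊎ y ≡ x ℤ.+ 1ℤ → ∃[ k ] 1ℤ ℤ.+ + 4 ℤ.* x ℤ.- + 4 ℤ.* y ≡ increment k
  carry x (inj₁ refl) = false , lem x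
    where
    lem : ∀ x → 1ℤ ℤ.+ + 4 ℤ.* x ℤ.- + 4 ℤ.* x ≡ 1ℤ
    lem = solve-∀
  carry x (inj₂ refl) = true , lem x
    where
    lem : ∀ x → 1ℤ ℤ.+ + 4 ℤ.* x ℤ.- + 4 ℤ.* (x ℤ.+ 1ℤ) ≡ ℤ.- (+ 3)
    lem = solve-∀

  -- Vertical edges leave their even end. For `b = ±1` the arguments of the two floors differ by
  -- `A - R * b`, which is 0 or 2|R| and hence at most `M`.
  step-vertical : ∀ b → 0ℤ ℤ.≤ A ℤ.- R ℤ.* b → 0ℤ ℤ.≤ A ℤ.+ R ℤ.* b → Odd (0ℤ , b) →
                  ∀ u → Even u → Step u (u ⊕ (0ℤ , b))
  step-vertical b 0≤A-Rb 0≤A+Rb b-odd u u-even =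
    map₂ (trans difference) (carry x (round-step (linear w ℤ.- A) (linear u) (A ℤ.- R ℤ.* b)
      (trans (lem₁ (linear u) A (R ℤ.* b)) (cong (λ x → x ℤ.- A ℤ.+ (A ℤ.- R ℤ.* b)) (sym linear-w)))
      0≤A-Rb
      (0≤M- (lem₂ N P A (R ℤ.* b)) (0≤+ (0≤+ 0≤N-P-A 0≤N+P-A) 0≤A+Rb))))
    where
    w = u ⊕ (0ℤ , b)
    lem₀ : ∀ i r p b → i ℤ.+ (p ℤ.* 0ℤ ℤ.+ r ℤ.* b) ≡ i ℤ.+ r ℤ.* b
    lem₀ = solve-∀
    linear-w : linear w ≡ linear u ℤ.+ R ℤ.* b
    linear-w = trans (linear-⊕ u (0ℤ , b)) (lem₀ (linear u) R (P ℤ.- N) b)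
    lem₁ : ∀ l a r → l ≡ l ℤ.+ r ℤ.- a ℤ.+ (a ℤ.- r)
    lem₁ = solve-∀
    lem₂ : ∀ n p a r → n ℤ.+ n ℤ.- (a ℤ.- r) ≡ n ℤ.- p ℤ.- a ℤ.+ (n ℤ.+ p ℤ.- a) ℤ.+ (a ℤ.+ r)
    lem₂ = solve-∀
    x = (linear w ℤ.- A) /ℕ M
    difference : height w ℤ.- height u ≡ 1ℤ ℤ.+ + 4 ℤ.* x ℤ.- + 4 ℤ.* (linear u /ℕ M)
    difference = trans
      (cong₂ ℤ._-_ (height-odd (class-⊕ u-even b-odd)) (height-even u-even))
      (lem (proj₁ u) x (linear u /ℕ M))
      where
      lem : ∀ i x y → + 2 ℤ.* (i ℤ.+ 0ℤ) ℤ.+ 1ℤ ℤ.+ + 4 ℤ.* x ℤ.- (+ 2 ℤ.* i ℤ.+ + 4 ℤ.* y) ≡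
                      1ℤ ℤ.+ + 4 ℤ.* x ℤ.- + 4 ℤ.* y
      lem = solve-∀

  step-up : ∀ u → Even u → Step u (u ⊕ (0ℤ , 1ℤ))
  step-up = step-vertical 1ℤ
    (subst (λ r → 0ℤ ℤ.≤ A ℤ.- r) (sym (ℤ.*-identityʳ R)) (0≤∣i∣-i R))
    (subst (λ r → 0ℤ ℤ.≤ A ℤ.+ r) (sym (ℤ.*-identityʳ R)) (0≤∣i∣+i R))
    (class 0ℤ refl)

  step-down : ∀ u → Even u → Step u (u ⊕ (0ℤ , -1ℤ))
  step-down = step-vertical -1ℤ
    (0≤-resp (lem₁ A R) (0≤∣i∣+i R))
    (0≤-resp (lem₂ A R) (0≤∣i∣-i R))
    (class -1ℤ refl)
    where
    lem₁ : ∀ a r → a ℤ.+ r ≡ a ℤ.- r ℤ.* -1ℤ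
    lem₁ = solve-∀
    lem₂ : ∀ a r → a ℤ.- r ≡ a ℤ.+ r ℤ.* -1ℤ
    lem₂ = solve-∀

  -- Horizontal edges leave their odd end. Here the argument drops by `2n - P - |R|`, whose
  -- nonnegativity is the bound for one sign of `P`.
  step-right : ∀ w → Odd w → Step w (w ⊕ (1ℤ , 0ℤ))
  step-right w w-odd =
    map₂ (trans difference) (carry x (round-step (linear u) (linear w ℤ.- A) (N ℤ.- P ℤ.- A)
      (trans (lem₁ (linear w) A N P) (cong (λ x → x ℤ.+ (N ℤ.- P ℤ.- A)) (sym linear-u)))
      0≤N-P-A
      (0≤M- (lem₂ N P A) (0≤+ (0≤+ 0≤N+P-A 0≤A) 0≤A))))
    where
    u = w ⊕ (1ℤ , 0ℤ)
    lem₀ : ∀ i r p → i ℤ.+ (p ℤ.* 1ℤ ℤ.+ r ℤ.* 0ℤ) ≡ i ℤ.+ p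
    lem₀ = solve-∀
    linear-u : linear u ≡ linear w ℤ.+ (P ℤ.- N)
    linear-u = trans (linear-⊕ w (1ℤ , 0ℤ)) (lem₀ (linear w) R (P ℤ.- N))
    lem₁ : ∀ l a n p → l ℤ.- a ≡ l ℤ.+ (p ℤ.- n) ℤ.+ (n ℤ.- p ℤ.- a)
    lem₁ = solve-∀
    lem₂ : ∀ n p a → n ℤ.+ n ℤ.- (n ℤ.- p ℤ.- a) ≡ n ℤ.+ p ℤ.- a ℤ.+ a ℤ.+ a
    lem₂ = solve-∀
    y = (linear w ℤ.- A) /ℕ M
    x = linear u /ℕ M
    difference : height u ℤ.- height w ≡ 1ℤ ℤ.+ + 4 ℤ.* x ℤ.- + 4 ℤ.* y
    difference = trans
      (cong₂ ℤ._-_ (height-even (class-⊕ w-odd (class {r = -1ℤ} 1ℤ refl))) (height-odd w-odd))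
      (lem (proj₁ w) x y)
      where
      lem : ∀ i x y → + 2 ℤ.* (i ℤ.+ 1ℤ) ℤ.+ + 4 ℤ.* x ℤ.- (+ 2 ℤ.* i ℤ.+ 1ℤ ℤ.+ + 4 ℤ.* y) ≡
                      1ℤ ℤ.+ + 4 ℤ.* x ℤ.- + 4 ℤ.* y
      lem = solve-∀

  -- The argument grows by `2n - P + |R|`, and this is at most `M` by the bound for the other sign
  -- of `P`. The base values differ by -3 = 1 - 4, so equal floors now mean a crossed edge; `flip`
  -- exchanges the alternatives accordingly.
  step-left : ∀ w → Odd w → Step w (w ⊕ (-1ℤ , 0ℤ))
  step-left w w-odd =
    map₂ (trans difference) (carry x (flip (round-step (linear w ℤ.- A) (linear u) (N ℤ.- P ℤ.+ A)
      (trans linear-u (lem₁ (linear w) A N P))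
      (0≤-resp (lem₃ N P A) (0≤+ (0≤+ 0≤N-P-A 0≤A) 0≤A))
      (0≤M- (lem₂ N P A) 0≤N+P-A))))
    where
    u = w ⊕ (-1ℤ , 0ℤ)
    lem₀ : ∀ i r p → i ℤ.+ (p ℤ.* -1ℤ ℤ.+ r ℤ.* 0ℤ) ≡ i ℤ.- p
    lem₀ = solve-∀
    linear-u : linear u ≡ linear w ℤ.- (P ℤ.- N)
    linear-u = trans (linear-⊕ w (-1ℤ , 0ℤ)) (lem₀ (linear w) R (P ℤ.- N))
    lem₁ : ∀ l a n p → l ℤ.- (p ℤ.- n) ≡ l ℤ.- a ℤ.+ (n ℤ.- p ℤ.+ a)
    lem₁ = solve-∀
    lem₂ : ∀ n p a → n ℤ.+ n ℤ.- (n ℤ.- p ℤ.+ a) ≡ n ℤ.+ p ℤ.- a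
    lem₂ = solve-∀
    lem₃ : ∀ n p a → n ℤ.- p ℤ.- a ℤ.+ a ℤ.+ a ≡ n ℤ.- p ℤ.+ a
    lem₃ = solve-∀
    y = (linear w ℤ.- A) /ℕ M
    x = linear u /ℕ M
    difference : height u ℤ.- height w ≡ 1ℤ ℤ.+ + 4 ℤ.* x ℤ.- + 4 ℤ.* (y ℤ.+ 1ℤ)
    difference = trans
      (cong₂ ℤ._-_ (height-even (class-⊕ w-odd (class {r = -1ℤ} 0ℤ refl))) (height-odd w-odd))
      (lem (proj₁ w) x y)
      where
      lem : ∀ i x y → + 2 ℤ.* (i ℤ.+ -1ℤ) ℤ.+ + 4 ℤ.* x ℤ.- (+ 2 ℤ.* i ℤ.+ 1ℤ ℤ.+ + 4 ℤ.* y) ≡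
                      1ℤ ℤ.+ + 4 ℤ.* x ℤ.- + 4 ℤ.* (y ℤ.+ 1ℤ)
      lem = solve-∀
    flip : ∀ {x y} → x ≡ y ⊎ x ≡ y ℤ.+ 1ℤ → y ℤ.+ 1ℤ ≡ x ⊎ y ℤ.+ 1ℤ ≡ x ℤ.+ 1ℤ
    flip (inj₁ refl) = inj₂ refl
    flip (inj₂ refl) = inj₁ refl

  step-black : ∀ {s} → Even s → ∀ e → Step (tail s e) (head s e)
  step-black {s} s-even left   = step-up s s-even
  step-black {s} s-even top    = subst (Step (s ⊕ (0ℤ , 1ℤ))) (⊕-assoc s _ _)
    (step-right (s ⊕ (0ℤ , 1ℤ)) (class-⊕ s-even (class {r = 1ℤ} 0ℤ refl)))
  step-black {s} s-even right  = subst (Step (s ⊕ (1ℤ , 1ℤ))) (⊕-assoc s _ _)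
    (step-down (s ⊕ (1ℤ , 1ℤ)) (class-⊕ s-even (class {r = 0ℤ} 1ℤ refl)))
  step-black {s} s-even bottom = subst (Step (s ⊕ (1ℤ , 0ℤ))) (trans (⊕-assoc s _ _) (⊕-identityʳ s))
    (step-left (s ⊕ (1ℤ , 0ℤ)) (class-⊕ s-even (class {r = 1ℤ} 0ℤ refl)))

  -- An edge is oriented counterclockwise around its white square, hence from `head` to `tail`.
  step-white : ∀ {s} → Odd s → ∀ e → Step (head s e) (tail s e)
  step-white {s} s-odd left   = subst (Step (s ⊕ (0ℤ , 1ℤ))) (trans (⊕-assoc s _ _) (⊕-identityʳ s))
    (step-down (s ⊕ (0ℤ , 1ℤ)) (class-⊕ s-odd (class {r = -1ℤ} 1ℤ refl)))
  step-white {s} s-odd top    = subst (Step (s ⊕ (1ℤ , 1ℤ))) (⊕-assoc s _ _)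
    (step-left (s ⊕ (1ℤ , 1ℤ)) (class-⊕ s-odd (class {r = 0ℤ} 1ℤ refl)))
  step-white {s} s-odd right  = subst (Step (s ⊕ (1ℤ , 0ℤ))) (⊕-assoc s _ _)
    (step-up (s ⊕ (1ℤ , 0ℤ)) (class-⊕ s-odd (class {r = -1ℤ} 1ℤ refl)))
  step-white {s} s-odd bottom = step-right s s-odd

  -- The tiling by dominoes across the jumps

  rise : Square → Side → ℤ
  rise s e = height (head s e) ℤ.- height (tail s e)

  perimeter-rise : ∀ s → perimeter (rise s) ≡ 0ℤ
  perimeter-rise s = telescope (height s) (height (s ⊕ (0ℤ , 1ℤ)))
                               (height (s ⊕ (1ℤ , 1ℤ))) (height (s ⊕ (1ℤ , 0ℤ)))
    where
    telescope : ∀ a b c d → (b ℤ.- a) ℤ.+ (c ℤ.- b) ℤ.+ (d ℤ.- c) ℤ.+ (a ℤ.- d) ≡ 0ℤ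
    telescope = solve-∀

  perimeter-cong : ∀ {f g : Side → ℤ} → (∀ e → f e ≡ g e) → perimeter f ≡ perimeter g
  perimeter-cong f≡g =
    cong₂ ℤ._+_ (cong₂ ℤ._+_ (cong₂ ℤ._+_ (f≡g left) (f≡g top)) (f≡g right)) (f≡g bottom)

  perimeter-neg : ∀ f → perimeter (λ e → ℤ.- f e) ≡ ℤ.- perimeter f
  perimeter-neg f = lem (f left) (f top) (f right) (f bottom)
    where
    lem : ∀ a b c d → (ℤ.- a) ℤ.+ (ℤ.- b) ℤ.+ (ℤ.- c) ℤ.+ (ℤ.- d) ≡ ℤ.- (a ℤ.+ b ℤ.+ c ℤ.+ d)
    lem = solve-∀

  -- Around a white square the increments are the negated rises, so absolute values give one
  -- statement for both colours.
  unique-jump-at : ∀ s → ∃[ e₀ ] (∀ e → ∣ rise s e ∣ ≡ ∣ increment (same e e₀) ∣)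
  unique-jump-at s with even⊎odd s
  ... | inj₁ s-even =
    let k = λ e → proj₁ (step-black s-even e)
        (e₀ , p) = unique-jump k (trans (perimeter-cong λ e → sym (proj₂ (step-black s-even e)))
                                        (perimeter-rise s))
    in e₀ , λ e → cong ∣_∣ (trans (proj₂ (step-black s-even e)) (cong increment (p e)))
  ... | inj₂ s-odd =
    let k = λ e → proj₁ (step-white s-odd e)
        eq : ∀ e → increment (k e) ≡ ℤ.- rise s e
        eq e = trans (sym (proj₂ (step-white s-odd e)))
                     (flip (height (tail s e)) (height (head s e)))
        (e₀ , p) = unique-jump k (trans (perimeter-cong eq)
          (trans (perimeter-neg (rise s)) (cong ℤ.-_ (perimeter-rise s))))
    in e₀ , λ e → trans (sym (ℤ.∣-i∣≡∣i∣ (rise s e)))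
                        (cong ∣_∣ (trans (sym (eq e)) (cong increment (p e))))
    where
    flip : ∀ a b → a ℤ.- b ≡ ℤ.- (b ℤ.- a)
    flip = solve-∀

  ∣increment∣≡3 : ∀ k → ∣ increment k ∣ ≡ 3 → k ≡ true
  ∣increment∣≡3 true  _ = refl
  ∣increment∣≡3 false ()

  -- The height difference along the common side of the two squares, unsigned because the
  -- orientation of that side depends on the colour of `s`.
  jump : Domino → ℕ
  jump (horizontal s) = ∣ height (s ⊕ (1ℤ , 1ℤ)) ℤ.- height (s ⊕ (1ℤ , 0ℤ)) ∣
  jump (vertical   s) = ∣ height (s ⊕ (1ℤ , 1ℤ)) ℤ.- height (s ⊕ (0ℤ , 1ℤ)) ∣

  jump-across : ∀ s e → jump (across s e) ≡ ∣ rise s e ∣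
  jump-across s left   = cong₂ (λ u w → ∣ height u ℤ.- height w ∣)
    (⊕-assoc s _ _) (trans (⊕-assoc s _ _) (⊕-identityʳ s))
  jump-across s top    = refl
  jump-across s right  = ℤ.∣i-j∣≡∣j-i∣ (height (s ⊕ (1ℤ , 1ℤ))) (height (s ⊕ (1ℤ , 0ℤ)))
  jump-across s bottom = trans
    (cong₂ (λ u w → ∣ height u ℤ.- height w ∣)
      (⊕-assoc s _ _) (trans (⊕-assoc s _ _) (⊕-identityʳ s)))
    (ℤ.∣i-j∣≡∣j-i∣ (height (s ⊕ (1ℤ , 0ℤ))) (height s))

  crossed : Pred Domino 0ℓ
  crossed d = jump d ≡ 3

  crossed-isTiling : IsTiling crossed
  crossed-isTiling = record { disjoint = disjoint ; covering = covering }
    where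
    only : ∀ {s d} → crossed d → s ∈ᵈ d → d ≡ across s (proj₁ (unique-jump-at s))
    only {s} {d} d∈T s∈d with ∈⇒across s d s∈d
    ... | e , refl = cong (across s) (same⇒≡ e e₀
            (∣increment∣≡3 _ (trans (sym (p e)) (trans (sym (jump-across s e)) d∈T))))
      where
      e₀ = proj₁ (unique-jump-at s)
      p = proj₂ (unique-jump-at s)
    disjoint : ∀ {d d′ s} → crossed d → crossed d′ → s ∈ᵈ d → s ∈ᵈ d′ → d ≡ d′
    disjoint d∈T d′∈T s∈d s∈d′ = trans (only d∈T s∈d) (sym (only d′∈T s∈d′))
    covering : ∀ s → ∃[ d ] (crossed d × s ∈ᵈ d)
    covering s = across s e₀ ,
      trans (jump-across s e₀) (trans (p e₀) (cong (λ k → ∣ increment k ∣) (same-refl e₀))) ,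
      self∈across s e₀
      where
      e₀ = proj₁ (unique-jump-at s)
      p = proj₂ (unique-jump-at s)

  height-isHeightFunction : IsHeightFunction crossed height
  height-isHeightFunction = record
    { origin    = height-origin
    ; uncrossed = λ s e s-black → uncross s e (step-black (black⇒even s-black) e)
    ; crossed   = λ s e s-black c → cross s e (step-black (black⇒even s-black) e)
                    (trans (sym (jump-across s e)) (crosses⇒across s e c))
    }
    where
    isolate : ∀ {a b c} → a ℤ.- b ≡ c → a ≡ b ℤ.+ c
    isolate {a} {b} eq = trans (lem a b) (cong (ℤ._+_ b) eq)
      where
      lem : ∀ a b → a ≡ b ℤ.+ (a ℤ.- b)
      lem = solve-∀
    uncross : ∀ s e → Step (tail s e) (head s e) → ¬ CrossesDomino crossed s e →
              height (head s e) ≡ height (tail s e) ℤ.+ 1ℤ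
    uncross s e (false , eq) _  = isolate eq
    uncross s e (true  , eq) ¬c =
      ⊥-elim (¬c (across⇒crosses s e (trans (jump-across s e) (cong ∣_∣ eq))))
    cross : ∀ s e → Step (tail s e) (head s e) → ∣ rise s e ∣ ≡ 3 →
            height (head s e) ≡ height (tail s e) ℤ.- + 3
    cross s e (k , eq) ∣rise∣≡3 with ∣increment∣≡3 k (trans (sym (cong ∣_∣ eq)) ∣rise∣≡3)
    ... | refl = isolate eq

  jump-shift : ∀ v t → (∀ u → height (u ⊕ v) ≡ height u ℤ.+ t) → ∀ d → jump (shift v d) ≡ jump d
  jump-shift v t eq = λ
    { (horizontal s) → cong ∣_∣ (difference-shift s _ _)
    ; (vertical   s) → cong ∣_∣ (difference-shift s _ _) }
    where
    open ≡-Reasoning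
    cancel : ∀ a b t → (a ℤ.+ t) ℤ.- (b ℤ.+ t) ≡ a ℤ.- b
    cancel = solve-∀
    difference-shift : ∀ s a b →
      height (s ⊕ v ⊕ a) ℤ.- height (s ⊕ v ⊕ b) ≡ height (s ⊕ a) ℤ.- height (s ⊕ b)
    difference-shift s a b = begin
      height (s ⊕ v ⊕ a) ℤ.- height (s ⊕ v ⊕ b)
        ≡⟨ cong₂ (λ x y → height x ℤ.- height y) (⊕-swap s v a) (⊕-swap s v b) ⟩
      height (s ⊕ a ⊕ v) ℤ.- height (s ⊕ b ⊕ v)
        ≡⟨ cong₂ ℤ._-_ (eq (s ⊕ a)) (eq (s ⊕ b)) ⟩
      (height (s ⊕ a) ℤ.+ t) ℤ.- (height (s ⊕ b) ℤ.+ t)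
        ≡⟨ cancel (height (s ⊕ a)) (height (s ⊕ b)) t ⟩
      height (s ⊕ a) ℤ.- height (s ⊕ b) ∎

-- Heights of a given tiling: growth along diagonals and residues modulo 4

ℤ-induction : (P : ℤ → Set) → P 0ℤ → (∀ i → P i → P (1ℤ ℤ.+ i)) → (∀ i → P (1ℤ ℤ.+ i) → P i) →
              ∀ i → P i
ℤ-induction P base up down (+ zero)       = base
ℤ-induction P base up down (+ suc n)      = up (+ n) (ℤ-induction P base up down (+ n))
ℤ-induction P base up down -[1+ zero ]    = down -[1+ 0 ] base
ℤ-induction P base up down -[1+ suc n ]   =
  down -[1+ suc n ] (ℤ-induction P base up down -[1+ n ])

walk-bound : (g : ℕ → ℤ) → (∀ n → ∣ g (suc n) ℤ.- g n ∣ ≡ 2) → ∀ n → ∣ g n ℤ.- g 0 ∣ ℕ.≤ 2 ℕ.* n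
walk-bound g step zero    = ℕ.≤-reflexive (cong ∣_∣ (ℤ.+-inverseʳ (g 0)))
walk-bound g step (suc n) = begin
  ∣ g (suc n) ℤ.- g 0 ∣                            ≡⟨ cong ∣_∣ (ℤ.+-minus-telescope (g (suc n)) (g n) (g 0)) ⟨
  ∣ (g (suc n) ℤ.- g n) ℤ.+ (g n ℤ.- g 0) ∣        ≤⟨ ℤ.∣i+j∣≤∣i∣+∣j∣ (g (suc n) ℤ.- g n) (g n ℤ.- g 0) ⟩
  ∣ g (suc n) ℤ.- g n ∣ ℕ.+ ∣ g n ℤ.- g 0 ∣        ≤⟨ ℕ.+-mono-≤ (ℕ.≤-reflexive (step n)) (walk-bound g step n) ⟩
  2 ℕ.+ 2 ℕ.* n                                    ≡⟨ ℕ.*-suc 2 n ⟨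
  2 ℕ.* suc n                                      ∎
  where open ℕ.≤-Reasoning

infix 4 _≡₄_

record _≡₄_ (i j : ℤ) : Set where
  constructor mod₄
  field
    quotient   : ℤ
    difference : i ≡ j ℤ.+ + 4 ℤ.* quotient

≡₄-trans : ∀ {i j k} → i ≡₄ j → j ≡₄ k → i ≡₄ k
≡₄-trans {k = k} (mod₄ a refl) (mod₄ b refl) = mod₄ (b ℤ.+ a) (lem k a b)
  where
  lem : ∀ k a b → k ℤ.+ + 4 ℤ.* b ℤ.+ + 4 ℤ.* a ≡ k ℤ.+ + 4 ℤ.* (b ℤ.+ a)
  lem = solve-∀

≡₄-sym : ∀ {i j} → i ≡₄ j → j ≡₄ i
≡₄-sym {j = j} (mod₄ a refl) = mod₄ (ℤ.- a) (lem j a)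
  where
  lem : ∀ j a → j ≡ j ℤ.+ + 4 ℤ.* a ℤ.+ + 4 ℤ.* (ℤ.- a)
  lem = solve-∀

≡₄-+ : ∀ {i j} c → i ≡₄ j → i ℤ.+ c ≡₄ j ℤ.+ c
≡₄-+ {j = j} c (mod₄ a refl) = mod₄ a (lem j a c)
  where
  lem : ∀ j a c → j ℤ.+ + 4 ℤ.* a ℤ.+ c ≡ j ℤ.+ c ℤ.+ + 4 ℤ.* a
  lem = solve-∀

≡₄-reflexive : ∀ {i j} → i ≡ j → i ≡₄ j
≡₄-reflexive {i} refl = mod₄ 0ℤ (sym (ℤ.+-identityʳ i))

module TilingHeight {T : Pred Domino 0ℓ} (tiling : IsTiling T)
                    {h : ℤ² → ℤ} (heightFunction : IsHeightFunction T h) where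
  open IsTiling tiling
  open IsHeightFunction heightFunction

  -- For an arbitrary predicate `T` crossing is not decidable by itself. The domino covering `s`
  -- provides the crossed side `e₀`, and disjointness excludes every other side.
  rises : ∀ s → s ∈ Black → ∃[ e₀ ] (∀ e → h (head s e) ≡ h (tail s e) ℤ.+ increment (same e e₀))
  rises s s-black with covering s
  ... | d , d∈T , s∈d with ∈⇒across s d s∈d
  ...   | e₀ , refl = e₀ , at
    where
    at : ∀ e → h (head s e) ≡ h (tail s e) ℤ.+ increment (same e e₀)
    at e with same e e₀ in eq
    ... | true  with same⇒≡ e e₀ eq
    ...   | refl = crossed s e s-black (across⇒crosses s e d∈T)
    at e | false = uncrossed s e s-black λ c →
      absurd (trans (sym eq) (trans (cong (λ f → same f e₀) (across-injective s e e₀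
        (disjoint (crosses⇒across s e c) d∈T (self∈across s e) s∈d))) (same-refl e₀)))
      where
      absurd : false ≡ true → ⊥
      absurd ()

  two-rises : ∀ {a b c x y} → b ≡ a ℤ.+ x → c ≡ b ℤ.+ y → c ℤ.- a ≡ x ℤ.+ y
  two-rises {a} {x = x} {y} refl refl = lem a x y
    where
    lem : ∀ a x y → a ℤ.+ x ℤ.+ y ℤ.- a ≡ x ℤ.+ y
    lem = solve-∀

  ∣diagonal-rise∣ : ∀ s → s ∈ Black → ∣ h (s ⊕ (1ℤ , 1ℤ)) ℤ.- h s ∣ ≡ 2
  ∣diagonal-rise∣ s s-black with rises s s-black
  ... | e₀ , p = trans (cong ∣_∣ (two-rises (p left) (p top))) (two e₀)
    where
    two : ∀ e₀ → ∣ increment (same left e₀) ℤ.+ increment (same top e₀) ∣ ≡ 2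
    two left   = refl
    two top    = refl
    two right  = refl
    two bottom = refl

  ∣antidiagonal-rise∣ : ∀ s → s ∈ Black → ∣ h (s ⊕ (1ℤ , 0ℤ)) ℤ.- h (s ⊕ (0ℤ , 1ℤ)) ∣ ≡ 2
  ∣antidiagonal-rise∣ s s-black with rises s s-black
  ... | e₀ , p = trans (cong ∣_∣ (two-rises (p top) (p right))) (two e₀)
    where
    two : ∀ e₀ → ∣ increment (same top e₀) ℤ.+ increment (same right e₀) ∣ ≡ 2
    two left   = refl
    two top    = refl
    two right  = refl
    two bottom = refl

  diagonal-bound : ∀ n → ∣ h (𝟎 ⊕ (+ n , + n)) ℤ.- h 𝟎 ∣ ℕ.≤ 2 ℕ.* n
  diagonal-bound = walk-bound (λ n → h (𝟎 ⊕ (+ n , + n))) λ n →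
    trans (cong₂ (λ u w → ∣ h u ℤ.- h w ∣) (cong₂ _,_ (lem₁ (+ n)) (lem₁ (+ n))) (⊕-identityˡ (+ n , + n)))
          (∣diagonal-rise∣ (+ n , + n) (even⇒black (+ n , + n) (class (+ n) (lem₂ (+ n)))))
    where
    lem₁ : ∀ z → 0ℤ ℤ.+ (1ℤ ℤ.+ z) ≡ z ℤ.+ 1ℤ
    lem₁ = solve-∀
    lem₂ : ∀ z → z ℤ.+ z ≡ 0ℤ ℤ.+ z ℤ.* + 2
    lem₂ = solve-∀

  -- The top and right sides of a black square join its two odd corners, so this walk starts at
  -- `(0 , 1)`. The flux condition holds at every base point, so this start is as good as the
  -- origin.
  antidiagonal-bound : ∀ n →
    ∣ h ((0ℤ , 1ℤ) ⊕ (+ n , ℤ.- + n)) ℤ.- h (0ℤ , 1ℤ) ∣ ℕ.≤ 2 ℕ.* n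
  antidiagonal-bound = walk-bound (λ n → h ((0ℤ , 1ℤ) ⊕ (+ n , ℤ.- + n))) λ n →
    trans (cong₂ (λ u w → ∣ h u ℤ.- h w ∣)
            (cong₂ _,_ (lem₁ (+ n)) (lem₃ (+ n)))
            (⊕-comm (0ℤ , 1ℤ) (+ n , ℤ.- + n)))
          (∣antidiagonal-rise∣ (+ n , ℤ.- + n) (even⇒black (+ n , ℤ.- + n) (class 0ℤ (ℤ.+-inverseʳ (+ n)))))
    where
    lem₁ : ∀ z → 0ℤ ℤ.+ (1ℤ ℤ.+ z) ≡ z ℤ.+ 1ℤ
    lem₁ = solve-∀
    lem₃ : ∀ z → 1ℤ ℤ.+ (ℤ.- (1ℤ ℤ.+ z)) ≡ ℤ.- z ℤ.+ 0ℤ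
    lem₃ = solve-∀

  rise≡₄ : ∀ s → Even s → ∀ e → h (head s e) ≡₄ h (tail s e) ℤ.+ 1ℤ
  rise≡₄ s s-even e with rises s (even⇒black s s-even)
  ... | e₀ , p with same e e₀ | p e
  ...   | false | eq = ≡₄-reflexive eq
  ...   | true  | eq = mod₄ -1ℤ (trans eq (sym (ℤ.+-assoc (h (tail s e)) 1ℤ (ℤ.- (+ 4)))))

  -- Oriented edges run to `u ⊕ (0 , 1)` both from `u` and from `u ⊕ (0 , 2)`. In `height-+2,0` the
  -- shared point `u ⊕ (1 , 0)` is the tail of both edges instead.
  height-+0,2 : ∀ u → Even u → h (u ⊕ (0ℤ , + 2)) ≡₄ h u
  height-+0,2 u u-even = ≡₄-cancel (≡₄-trans (≡₄-sym down) (rise≡₄ u u-even left))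
    where
    ≡₄-cancel : ∀ {i j} → i ℤ.+ 1ℤ ≡₄ j ℤ.+ 1ℤ → i ≡₄ j
    ≡₄-cancel {i} {j} p = subst₂ _≡₄_ (lem i) (lem j) (≡₄-+ -1ℤ p)
      where
      lem : ∀ i → i ℤ.+ 1ℤ ℤ.+ -1ℤ ≡ i
      lem = solve-∀
    t = u ⊕ (-1ℤ , 1ℤ)
    down : h (u ⊕ (0ℤ , 1ℤ)) ≡₄ h (u ⊕ (0ℤ , + 2)) ℤ.+ 1ℤ
    down = subst₂ (λ a b → h a ≡₄ h b ℤ.+ 1ℤ) (⊕-assoc u _ _) (⊕-assoc u _ _)
      (rise≡₄ t (class-⊕ u-even (class {r = 0ℤ} 0ℤ refl)) right)

  height-+2,0 : ∀ u → Even u → h (u ⊕ (+ 2 , 0ℤ)) ≡₄ h u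
  height-+2,0 u u-even = ≡₄-trans along (≡₄-sym (rise≡₄ u u-even bottom))
    where
    t = u ⊕ (1ℤ , -1ℤ)
    along : h (u ⊕ (+ 2 , 0ℤ)) ≡₄ h (u ⊕ (1ℤ , 0ℤ)) ℤ.+ 1ℤ
    along = subst₂ (λ a b → h a ≡₄ h b ℤ.+ 1ℤ) (⊕-assoc u _ _) (⊕-assoc u _ _)
      (rise≡₄ t (class-⊕ u-even (class {r = 0ℤ} 0ℤ refl)) top)

  height-+1,1 : ∀ u → Even u → h (u ⊕ (1ℤ , 1ℤ)) ≡₄ h u ℤ.+ + 2
  height-+1,1 u u-even = ≡₄-trans (rise≡₄ u u-even top)
    (≡₄-trans (≡₄-+ 1ℤ (rise≡₄ u u-even left)) (≡₄-reflexive (ℤ.+-assoc (h u) 1ℤ 1ℤ)))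

  height-𝓔 : ∀ v → v ∈ 𝓔 → h v ≡₄ 0ℤ
  height-𝓔 v (w , refl) = all (proj₁ w) (proj₂ w)
    where
    H : ℤ → ℤ → ℤ
    H a b = h ((+ 2) ⊛ (a , b))
    lem₁ : ∀ a → + 2 ℤ.* (1ℤ ℤ.+ a) ≡ + 2 ℤ.* a ℤ.+ + 2
    lem₁ = solve-∀
    lem₂ : ∀ a → + 2 ℤ.* a ≡ + 2 ℤ.* a ℤ.+ 0ℤ
    lem₂ = solve-∀
    H-suc₁ : ∀ a b → H (1ℤ ℤ.+ a) b ≡₄ H a b
    H-suc₁ a b = subst (_≡₄ H a b) (cong h (cong₂ _,_ (sym (lem₁ a)) (sym (lem₂ b))))
      (height-+2,0 _ (valid⇒even (inj₁ ((a , b) , refl))))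
    H-suc₂ : ∀ a b → H a (1ℤ ℤ.+ b) ≡₄ H a b
    H-suc₂ a b = subst (_≡₄ H a b) (cong h (cong₂ _,_ (sym (lem₂ a)) (sym (lem₁ b))))
      (height-+0,2 _ (valid⇒even (inj₁ ((a , b) , refl))))
    row : ∀ a → H a 0ℤ ≡₄ 0ℤ
    row = ℤ-induction (λ a → H a 0ℤ ≡₄ 0ℤ) (≡₄-reflexive origin)
      (λ a → ≡₄-trans (H-suc₁ a 0ℤ)) (λ a → ≡₄-trans (≡₄-sym (H-suc₁ a 0ℤ)))
    all : ∀ a b → H a b ≡₄ 0ℤ
    all a = ℤ-induction (λ b → H a b ≡₄ 0ℤ) (row a)
      (λ b → ≡₄-trans (H-suc₂ a b)) (λ b → ≡₄-trans (≡₄-sym (H-suc₂ a b)))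

  height-𝓞 : ∀ v → v ∈ 𝓞 → h v ≡₄ + 2
  height-𝓞 v (w , refl) = ≡₄-trans (height-+1,1 _ (valid⇒even (inj₁ (w , refl))))
    (≡₄-+ (+ 2) (height-𝓔 _ (w , refl)))

-- Integers as rationals

ι : ℤ → ℚ
ι i = i ℚ./ 1

private
  ιᵘ : ℤ → ℚᵘ.ℚᵘ
  ιᵘ i = ℚᵘ.mkℚᵘ i 0

  toℚᵘ-ι : ∀ i → ℚ.toℚᵘ (ι i) ℚᵘ.≃ ιᵘ i
  toℚᵘ-ι i = ℚ.toℚᵘ-fromℚᵘ (ιᵘ i)

ι-+ : ∀ i j → ι (i ℤ.+ j) ≡ ι i ℚ.+ ι j
ι-+ i j = ℚ.toℚᵘ-injective (begin-equality
  ℚ.toℚᵘ (ι (i ℤ.+ j))                ≃⟨ toℚᵘ-ι (i ℤ.+ j) ⟩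
  ιᵘ (i ℤ.+ j)                        ≃⟨ ℚᵘ.*≡* (lem i j) ⟩
  ιᵘ i ℚᵘ.+ ιᵘ j                      ≃⟨ ℚᵘ.+-cong (toℚᵘ-ι i) (toℚᵘ-ι j) ⟨
  ℚ.toℚᵘ (ι i) ℚᵘ.+ ℚ.toℚᵘ (ι j)      ≃⟨ ℚ.toℚᵘ-homo-+ (ι i) (ι j) ⟨
  ℚ.toℚᵘ (ι i ℚ.+ ι j)                ∎)
  where
  open ℚᵘ.≤-Reasoning
  lem : ∀ i j → (i ℤ.+ j) ℤ.* 1ℤ ≡ (i ℤ.* 1ℤ ℤ.+ j ℤ.* 1ℤ) ℤ.* 1ℤ
  lem = solve-∀

ι-* : ∀ i j → ι (i ℤ.* j) ≡ ι i ℚ.* ι j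
ι-* i j = ℚ.toℚᵘ-injective (begin-equality
  ℚ.toℚᵘ (ι (i ℤ.* j))                ≃⟨ toℚᵘ-ι (i ℤ.* j) ⟩
  ιᵘ i ℚᵘ.* ιᵘ j                      ≃⟨ ℚᵘ.*-cong (toℚᵘ-ι i) (toℚᵘ-ι j) ⟨
  ℚ.toℚᵘ (ι i) ℚᵘ.* ℚ.toℚᵘ (ι j)      ≃⟨ ℚ.toℚᵘ-homo-* (ι i) (ι j) ⟨
  ℚ.toℚᵘ (ι i ℚ.* ι j)                ∎)
  where open ℚᵘ.≤-Reasoning

ι-neg : ∀ i → ι (ℤ.- i) ≡ ℚ.- ι i
ι-neg (+ zero)  = refl
ι-neg (+ suc n) = refl
ι-neg -[1+ n ]  = solveℚ 1 (λ p → p := :- (:- p)) refl (ι (+ suc n))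

ι-mono-≤ : ∀ {i j} → i ℤ.≤ j → ι i ℚ.≤ ι j
ι-mono-≤ {i} {j} i≤j = ℚ.toℚᵘ-cancel-≤ (begin
  ℚ.toℚᵘ (ι i)    ≃⟨ toℚᵘ-ι i ⟩
  ιᵘ i            ≤⟨ ℚᵘ.*≤* (ℤ.*-monoʳ-≤-nonNeg 1ℤ i≤j) ⟩
  ιᵘ j            ≃⟨ toℚᵘ-ι j ⟨
  ℚ.toℚᵘ (ι j)    ∎)
  where open ℚᵘ.≤-Reasoning

ι-cancel-≤ : ∀ {i j} → ι i ℚ.≤ ι j → i ℤ.≤ j
ι-cancel-≤ {i} {j} ιi≤ιj = ℤ.*-cancelʳ-≤-pos i j 1ℤ (ℚᵘ.drop-*≤* (begin
  ιᵘ i            ≃⟨ toℚᵘ-ι i ⟨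
  ℚ.toℚᵘ (ι i)    ≤⟨ ℚ.toℚᵘ-mono-≤ ιi≤ιj ⟩
  ℚ.toℚᵘ (ι j)    ≃⟨ toℚᵘ-ι j ⟩
  ιᵘ j            ∎))
  where open ℚᵘ.≤-Reasoning

ι-∣∣ : ∀ i → ℚ.∣ ι i ∣ ≡ ι (+ ∣ i ∣)
ι-∣∣ (+ n)    = ℚ.0≤p⇒∣p∣≡p (ι-mono-≤ {0ℤ} {+ n} (+≤+ ℕ.z≤n))
ι-∣∣ -[1+ n ] = trans (ℚ.∣-p∣≡∣p∣ (ι (+ suc n))) (ι-∣∣ (+ suc n))

ι-pos : ∀ n .{{_ : ℕ.NonZero n}} → ℚ.Positive (ι (+ n))
ι-pos n = ℚ.normalize-pos n 1

-- Limits of rational sequences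

-- The field is what `x ≈ fromℚ p` unfolds to when `s` is `seq x`. The record keeps `s` and `p`
-- visible to unification and carries no Cauchy proof.
record Lim (s : ℕ → ℚ) (p : ℚ) : Set where
  constructor lim
  field
    close : ∀ ε → 0ℚ ℚ.< ε → ∃[ N ] (∀ n → N ℕ.≤ n → ℚ.∣ s n ℚ.- p ∣ ℚ.< ε)

open Lim

scale-pos : ∀ c .{{_ : ℚ.Positive c}} {ε} → 0ℚ ℚ.< ε → 0ℚ ℚ.< c ℚ.* ε
scale-pos c {ε} 0<ε = subst (ℚ._< c ℚ.* ε) (ℚ.*-zeroʳ c) (ℚ.*-monoʳ-<-pos c 0<ε)

Lim-cong : ∀ {s t p q} → (∀ n → s n ≡ t n) → p ≡ q → Lim s p → Lim t q
Lim-cong s≡t refl s⟶p .close ε 0<ε with close s⟶p ε 0<ε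
... | N , near = N , λ n N≤n → subst (λ x → ℚ.∣ x ℚ.- _ ∣ ℚ.< ε) (s≡t n) (near n N≤n)

Lim-+ : ∀ {s t p q} → Lim s p → Lim t q → Lim (λ n → s n ℚ.+ t n) (p ℚ.+ q)
Lim-+ {s} {t} {p} {q} s⟶p t⟶q .close ε 0<ε
  with close s⟶p (½ ℚ.* ε) (scale-pos ½ 0<ε) | close t⟶q (½ ℚ.* ε) (scale-pos ½ 0<ε)
... | M , near-s | N , near-t = M ℕ.⊔ N , λ n M⊔N≤n → begin-strict
  ℚ.∣ (s n ℚ.+ t n) ℚ.- (p ℚ.+ q) ∣            ≡⟨ cong ℚ.∣_∣ (interchange (s n) (t n) p q) ⟩
  ℚ.∣ (s n ℚ.- p) ℚ.+ (t n ℚ.- q) ∣            ≤⟨ ℚ.∣p+q∣≤∣p∣+∣q∣ (s n ℚ.- p) (t n ℚ.- q) ⟩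
  ℚ.∣ s n ℚ.- p ∣ ℚ.+ ℚ.∣ t n ℚ.- q ∣          <⟨ ℚ.+-mono-< (near-s n (ℕ.m⊔n≤o⇒m≤o M N M⊔N≤n))
                                                            (near-t n (ℕ.m⊔n≤o⇒n≤o M N M⊔N≤n)) ⟩
  ½ ℚ.* ε ℚ.+ ½ ℚ.* ε                          ≡⟨ halves ε ⟩
  ε                                            ∎
  where
  open ℚ.≤-Reasoning
  interchange : ∀ a b c d → (a ℚ.+ b) ℚ.- (c ℚ.+ d) ≡ (a ℚ.- c) ℚ.+ (b ℚ.- d)
  interchange = solveℚ 4 (λ a b c d → (a :+ b) :- (c :+ d) := (a :- c) :+ (b :- d)) refl
  halves : ∀ e → ½ ℚ.* e ℚ.+ ½ ℚ.* e ≡ e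
  halves = solveℚ 1 (λ e → con ½ :* e :+ con ½ :* e := e) refl

Lim-* : ∀ c {s p} → Lim s p → Lim (λ n → c ℚ.* s n) (c ℚ.* p)
Lim-* c {s} {p} s⟶p .close ε 0<ε = proj₁ near , λ n N≤n → begin-strict
  ℚ.∣ c ℚ.* s n ℚ.- c ℚ.* p ∣            ≡⟨ cong ℚ.∣_∣ (factor c (s n) p) ⟩
  ℚ.∣ c ℚ.* (s n ℚ.- p) ∣                ≡⟨ ℚ.∣p*q∣≡∣p∣*∣q∣ c (s n ℚ.- p) ⟩
  ℚ.∣ c ∣ ℚ.* ℚ.∣ s n ℚ.- p ∣            ≤⟨ ℚ.*-monoʳ-≤-nonNeg ℚ.∣ s n ℚ.- p ∣ {{ℚ.∣-∣-nonNeg (s n ℚ.- p)}} ∣c∣≤b ⟩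
  b ℚ.* ℚ.∣ s n ℚ.- p ∣                  <⟨ ℚ.*-monoʳ-<-pos b (proj₂ near n N≤n) ⟩
  b ℚ.* (ℚ.1/ b ℚ.* ε)                   ≡⟨ ℚ.*-assoc b (ℚ.1/ b) ε ⟨
  b ℚ.* ℚ.1/ b ℚ.* ε                     ≡⟨ cong (ℚ._* ε) (ℚ.*-inverseʳ b) ⟩
  1ℚ ℚ.* ε                               ≡⟨ ℚ.*-identityˡ ε ⟩
  ε                                      ∎
  where
  open ℚ.≤-Reasoning
  -- The summand 1 keeps `b` invertible when `c` is zero.
  b : ℚ
  b = 1ℚ ℚ.+ ℚ.∣ c ∣
  instance
    b>0 : ℚ.Positive b
    b>0 = ℚ.pos+nonNeg⇒pos 1ℚ ℚ.∣ c ∣ {{ℚ.∣-∣-nonNeg c}}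
    b≢0 : ℚ.NonZero b
    b≢0 = ℚ.pos⇒nonZero b
    1/b>0 : ℚ.Positive (ℚ.1/ b)
    1/b>0 = ℚ.1/pos⇒pos b
  ∣c∣≤b : ℚ.∣ c ∣ ℚ.≤ b
  ∣c∣≤b = subst (ℚ._≤ b) (ℚ.+-identityˡ ℚ.∣ c ∣)
    (ℚ.+-monoˡ-≤ ℚ.∣ c ∣ (ℚ.<⇒≤ (ℚ.positive⁻¹ 1ℚ)))
  near : ∃[ N ] (∀ n → N ℕ.≤ n → ℚ.∣ s n ℚ.- p ∣ ℚ.< ℚ.1/ b ℚ.* ε)
  near = close s⟶p (ℚ.1/ b ℚ.* ε) (scale-pos (ℚ.1/ b) 0<ε)
  factor : ∀ c x y → c ℚ.* x ℚ.- c ℚ.* y ≡ c ℚ.* (x ℚ.- y)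
  factor = solveℚ 3 (λ c x y → c :* x :- c :* y := c :* (x :- y)) refl

-- Convergence of `s` is a conclusion here, and its limit is rational; this is how the coordinates
-- of a flux turn out to be rational.
Lim-divide : ∀ c .{{_ : ℚ.NonZero c}} s {q} → Lim (λ k → c ℚ.* s k) q →
             ∃[ p ] Lim s p × c ℚ.* p ≡ q
Lim-divide c s {q} cs⟶q = ℚ.1/ c ℚ.* q ,
  Lim-cong (λ k → cancel (ℚ.1/ c) c (s k) (ℚ.*-inverseˡ c)) refl (Lim-* (ℚ.1/ c) cs⟶q) ,
  cancel c (ℚ.1/ c) q (ℚ.*-inverseʳ c)
  where
  cancel : ∀ a b x → a ℚ.* b ≡ 1ℚ → a ℚ.* (b ℚ.* x) ≡ x
  cancel a b x ab≡1 =
    trans (sym (ℚ.*-assoc a b x)) (trans (cong (ℚ._* x) ab≡1) (ℚ.*-identityˡ x))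

-- If q < p, the choice ε = p - q yields p < p.
≤-+ε : ∀ {p q} → (∀ ε → 0ℚ ℚ.< ε → p ℚ.< q ℚ.+ ε) → p ℚ.≤ q
≤-+ε {p} {q} p<q+ε = ℚ.≮⇒≥ λ q<p → ℚ.<-irrefl refl
  (subst (p ℚ.<_) (lem p q)
    (p<q+ε (p ℚ.- q) (subst (ℚ._< p ℚ.- q) (ℚ.+-inverseʳ q) (ℚ.+-monoˡ-< (ℚ.- q) q<p))))
  where
  lem : ∀ p q → q ℚ.+ (p ℚ.- q) ≡ p
  lem = solveℚ 2 (λ p q → q :+ (p :- q) := p) refl

∣∣-near : ∀ p q {ε} → ℚ.∣ p ℚ.- q ∣ ℚ.< ε → ℚ.∣ p ∣ ℚ.< ℚ.∣ q ∣ ℚ.+ ε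
∣∣-near p q {ε} near = begin-strict
  ℚ.∣ p ∣                              ≡⟨ cong ℚ.∣_∣ (lem p q) ⟩
  ℚ.∣ q ℚ.+ (p ℚ.- q) ∣                ≤⟨ ℚ.∣p+q∣≤∣p∣+∣q∣ q (p ℚ.- q) ⟩
  ℚ.∣ q ∣ ℚ.+ ℚ.∣ p ℚ.- q ∣            <⟨ ℚ.+-monoʳ-< ℚ.∣ q ∣ near ⟩
  ℚ.∣ q ∣ ℚ.+ ε                        ∎
  where
  open ℚ.≤-Reasoning
  lem : ∀ p q → p ≡ q ℚ.+ (p ℚ.- q)
  lem = solveℚ 2 (λ p q → p := q :+ (p :- q)) refl

∣p-q∣≡∣q-p∣ : ∀ p q → ℚ.∣ p ℚ.- q ∣ ≡ ℚ.∣ q ℚ.- p ∣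
∣p-q∣≡∣q-p∣ p q = trans (cong ℚ.∣_∣ (lem p q)) (ℚ.∣-p∣≡∣p∣ (q ℚ.- p))
  where
  lem : ∀ p q → p ℚ.- q ≡ ℚ.- (q ℚ.- p)
  lem = solveℚ 2 (λ p q → p :- q := :- (q :- p)) refl

-- The first case is that of equal signs, the second that of opposite signs. Hence bounds on |x + y|
-- and |x - y| cut out the square `Q`.
∣p∣+∣q∣≡∣p±q∣ : ∀ p q → ℚ.∣ p ∣ ℚ.+ ℚ.∣ q ∣ ≡ ℚ.∣ p ℚ.+ q ∣ ⊎ ℚ.∣ p ∣ ℚ.+ ℚ.∣ q ∣ ≡ ℚ.∣ p ℚ.- q ∣
∣p∣+∣q∣≡∣p±q∣ p q = cases (ℚ.∣p∣≡p∨∣p∣≡-p p) (ℚ.∣p∣≡p∨∣p∣≡-p q)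
  where
  s : ℚ
  s = ℚ.∣ p ∣ ℚ.+ ℚ.∣ q ∣
  abs : ∀ {r} → s ≡ r → s ≡ ℚ.∣ r ∣
  abs eq = trans (sym (ℚ.0≤p⇒∣p∣≡p (ℚ.+-mono-≤ (ℚ.0≤∣p∣ p) (ℚ.0≤∣p∣ q)))) (cong ℚ.∣_∣ eq)
  abs-neg : ∀ {r} → s ≡ ℚ.- r → s ≡ ℚ.∣ r ∣
  abs-neg {r} eq = trans (abs eq) (ℚ.∣-p∣≡∣p∣ r)
  cases : ℚ.∣ p ∣ ≡ p ⊎ ℚ.∣ p ∣ ≡ ℚ.- p → ℚ.∣ q ∣ ≡ q ⊎ ℚ.∣ q ∣ ≡ ℚ.- q →
          s ≡ ℚ.∣ p ℚ.+ q ∣ ⊎ s ≡ ℚ.∣ p ℚ.- q ∣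
  cases (inj₁ a) (inj₁ b) = inj₁ (abs (cong₂ ℚ._+_ a b))
  cases (inj₂ a) (inj₂ b) =
    inj₁ (abs-neg (trans (cong₂ ℚ._+_ a b) (sym (ℚ.neg-distrib-+ p q))))
  cases (inj₁ a) (inj₂ b) = inj₂ (abs (cong₂ ℚ._+_ a b))
  cases (inj₂ a) (inj₁ b) = inj₂ (abs-neg (trans (cong₂ ℚ._+_ a b) (lem p q)))
    where
    lem : ∀ p q → ℚ.- p ℚ.+ q ≡ ℚ.- (p ℚ.- q)
    lem = solveℚ 2 (λ p q → :- p :+ q := :- (p :- q)) refl

-- Lattices

square-abs : ∀ i → + (∣ i ∣ ℕ.* ∣ i ∣) ≡ i ℤ.* i
square-abs (+ n)    = ℤ.pos-* n n
square-abs -[1+ n ] = refl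

module Lattice (L : ValidLattice) where
  open ValidLattice L

  a₀ b₀ a₁ b₁ : ℤ
  a₀ = proj₁ v₀
  b₀ = proj₂ v₀
  a₁ = proj₁ v₁
  b₁ = proj₂ v₁

  det : ℤ
  det = a₀ ℤ.* b₁ ℤ.- a₁ ℤ.* b₀

  -- Were it zero, `(b₁ , - b₀)` and `(a₁ , - a₀)` would be relations between `v₀` and `v₁`; all
  -- four coordinates would vanish, and then `v₀ = 𝟎` is itself a forbidden relation.
  det≢0 : det ≢ 0ℤ
  det≢0 det≡0 = 1≢0 (proj₁ (independent 1ℤ 0ℤ 1⊛v₀≡𝟎))
    where
    zeros₁ : b₁ ≡ 0ℤ × ℤ.- b₀ ≡ 0ℤ
    zeros₁ = independent b₁ (ℤ.- b₀) (cong₂ _,_ (trans (lem₁ a₀ b₀ a₁ b₁) det≡0) (lem₂ b₀ b₁))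
      where
      lem₁ : ∀ a₀ b₀ a₁ b₁ → b₁ ℤ.* a₀ ℤ.+ (ℤ.- b₀) ℤ.* a₁ ≡ a₀ ℤ.* b₁ ℤ.- a₁ ℤ.* b₀
      lem₁ = solve-∀
      lem₂ : ∀ b₀ b₁ → b₁ ℤ.* b₀ ℤ.+ (ℤ.- b₀) ℤ.* b₁ ≡ 0ℤ
      lem₂ = solve-∀
    zeros₂ : a₁ ≡ 0ℤ × ℤ.- a₀ ≡ 0ℤ
    zeros₂ = independent a₁ (ℤ.- a₀)
      (cong₂ _,_ (lem₂ a₀ a₁) (trans (lem₁ a₀ b₀ a₁ b₁) (cong ℤ.-_ det≡0)))
      where
      lem₁ : ∀ a₀ b₀ a₁ b₁ → a₁ ℤ.* b₀ ℤ.+ (ℤ.- a₀) ℤ.* b₁ ≡ ℤ.- (a₀ ℤ.* b₁ ℤ.- a₁ ℤ.* b₀)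
      lem₁ = solve-∀
      lem₂ : ∀ a₀ a₁ → a₁ ℤ.* a₀ ℤ.+ (ℤ.- a₀) ℤ.* a₁ ≡ 0ℤ
      lem₂ = solve-∀
    1≢0 : 1ℤ ≢ 0ℤ
    1≢0 ()
    1⊛v₀≡𝟎 : 1ℤ ⊛ v₀ ⊕ 0ℤ ⊛ v₁ ≡ 𝟎
    1⊛v₀≡𝟎 = cong₂ _,_ (trans (lem a₀ a₁) (ℤ.neg-injective (proj₂ zeros₂)))
                       (trans (lem b₀ b₁) (ℤ.neg-injective (proj₂ zeros₁)))
      where
      lem : ∀ a b → 1ℤ ℤ.* a ℤ.+ 0ℤ ℤ.* b ≡ a
      lem = solve-∀

  -- The square of the determinant, to avoid a case distinction on its sign.
  n : ℕ
  n = ∣ det ∣ ℕ.* ∣ det ∣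

  +n≡ : + n ≡ det ℤ.* det
  +n≡ = square-abs det

  instance
    n≢0 : ℕ.NonZero n
    n≢0 = ℕ.m*n≢0 ∣ det ∣ ∣ det ∣ {{nz}} {{nz}}
      where
      nz : ℕ.NonZero ∣ det ∣
      nz = ℤ.≢-nonZero det≢0

  v₀∈L : v₀ ∈ ⟦ L ⟧
  v₀∈L = 1ℤ , 0ℤ , cong₂ _,_ (lem a₀ a₁) (lem b₀ b₁)
    where
    lem : ∀ a b → a ≡ 1ℤ ℤ.* a ℤ.+ 0ℤ ℤ.* b
    lem = solve-∀

  v₁∈L : v₁ ∈ ⟦ L ⟧
  v₁∈L = 0ℤ , 1ℤ , cong₂ _,_ (lem a₀ a₁) (lem b₀ b₁)
    where
    lem : ∀ a b → b ≡ 0ℤ ℤ.* a ℤ.+ 1ℤ ℤ.* b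
    lem = solve-∀

  -- Cramer's rule writes `det` times (1,1) as an integer combination of the basis; one more factor
  -- `det` makes the multiple `n`. The vector `(n , -n)` arises in the same way.
  n,n∈L : (+ n , + n) ∈ ⟦ L ⟧
  n,n∈L = det ℤ.* (b₁ ℤ.- a₁) , det ℤ.* (a₀ ℤ.- b₀) ,
    cong₂ _,_ (trans +n≡ (lem₁ a₀ b₀ a₁ b₁)) (trans +n≡ (lem₂ a₀ b₀ a₁ b₁))
    where
    lem₁ : ∀ a₀ b₀ a₁ b₁ → let d = a₀ ℤ.* b₁ ℤ.- a₁ ℤ.* b₀ in
           d ℤ.* d ≡ d ℤ.* (b₁ ℤ.- a₁) ℤ.* a₀ ℤ.+ d ℤ.* (a₀ ℤ.- b₀) ℤ.* a₁
    lem₁ = solve-∀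
    lem₂ : ∀ a₀ b₀ a₁ b₁ → let d = a₀ ℤ.* b₁ ℤ.- a₁ ℤ.* b₀ in
           d ℤ.* d ≡ d ℤ.* (b₁ ℤ.- a₁) ℤ.* b₀ ℤ.+ d ℤ.* (a₀ ℤ.- b₀) ℤ.* b₁
    lem₂ = solve-∀

  n,-n∈L : (+ n , ℤ.- + n) ∈ ⟦ L ⟧
  n,-n∈L = det ℤ.* (b₁ ℤ.+ a₁) , det ℤ.* (ℤ.- a₀ ℤ.- b₀) ,
    cong₂ _,_ (trans +n≡ (lem₁ a₀ b₀ a₁ b₁))
              (trans (cong ℤ.-_ +n≡) (lem₂ a₀ b₀ a₁ b₁))
    where
    lem₁ : ∀ a₀ b₀ a₁ b₁ → let d = a₀ ℤ.* b₁ ℤ.- a₁ ℤ.* b₀ in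
           d ℤ.* d ≡ d ℤ.* (b₁ ℤ.+ a₁) ℤ.* a₀ ℤ.+ d ℤ.* (ℤ.- a₀ ℤ.- b₀) ℤ.* a₁
    lem₁ = solve-∀
    lem₂ : ∀ a₀ b₀ a₁ b₁ → let d = a₀ ℤ.* b₁ ℤ.- a₁ ℤ.* b₀ in
           ℤ.- (d ℤ.* d) ≡ d ℤ.* (b₁ ℤ.+ a₁) ℤ.* b₀ ℤ.+ d ℤ.* (ℤ.- a₀ ℤ.- b₀) ℤ.* b₁
    lem₂ = solve-∀

  ∈L⇒even : ∀ {v} → v ∈ ⟦ L ⟧ → Even v
  ∈L⇒even (a , b , refl) =
    class-⊕ (even-⊛ a (valid⇒even v₀∈𝓔⊎𝓞)) (even-⊛ b (valid⇒even v₁∈𝓔⊎𝓞))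

-- From tilings to fluxes

four quarter : ℚ
four    = + 4 ℚ./ 1
quarter = + 1 ℚ./ 4

4*-cancel : ∀ s {p} → Lim (λ k → four ℚ.* s k) p → Lim s (quarter ℚ.* p)
4*-cancel s 4s⟶p = Lim-cong (λ k → lem (s k)) refl (Lim-* quarter 4s⟶p)
  where
  lem : ∀ x → quarter ℚ.* (four ℚ.* x) ≡ x
  lem = solveℚ 1 (λ x → con quarter :* (con four :* x) := x) refl

ι-4* : ∀ k → ι (+ 4 ℤ.* k) ≡ four ℚ.* ι k
ι-4* = ι-* (+ 4)

-- Dividing by `4n` turns the walk bound `2n` into the constant ½ of `Q`.
Lim-unscale : ∀ n .{{_ : ℕ.NonZero n}} {s : ℕ → ℚ} {t} → ∣ t ∣ ℕ.≤ 2 ℕ.* n →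
              Lim (λ k → four ℚ.* (ι (+ n) ℚ.* s k)) (ι t) →
              ∃[ p ] Lim s p × ℚ.∣ p ∣ ℚ.≤ ½
Lim-unscale n {s} {t} ∣t∣≤2n 4ns⟶t = p , proj₁ (proj₂ limit) , ℚ.*-cancelˡ-≤-pos N (begin
  N ℚ.* ℚ.∣ p ∣                       ≡⟨ cong (ℚ._* ℚ.∣ p ∣) (ι-∣∣ (+ n)) ⟨
  ℚ.∣ N ∣ ℚ.* ℚ.∣ p ∣                 ≡⟨ ℚ.∣p*q∣≡∣p∣*∣q∣ N p ⟨
  ℚ.∣ N ℚ.* p ∣                       ≡⟨ cong ℚ.∣_∣ (proj₂ (proj₂ limit)) ⟩
  ℚ.∣ quarter ℚ.* ι t ∣               ≡⟨ ℚ.∣p*q∣≡∣p∣*∣q∣ quarter (ι t) ⟩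
  quarter ℚ.* ℚ.∣ ι t ∣               ≡⟨ cong (quarter ℚ.*_) (ι-∣∣ t) ⟩
  quarter ℚ.* ι (+ ∣ t ∣)             ≤⟨ ℚ.*-monoˡ-≤-nonNeg quarter (ι-mono-≤ (+≤+ ∣t∣≤2n)) ⟩
  quarter ℚ.* ι (+ (2 ℕ.* n))         ≡⟨ cong (quarter ℚ.*_) (trans (cong ι (ℤ.pos-* 2 n)) (ι-* (+ 2) (+ n))) ⟩
  quarter ℚ.* (ι (+ 2) ℚ.* N)         ≡⟨ lem N ⟩
  N ℚ.* ½                             ∎)
  where
  open ℚ.≤-Reasoning
  N : ℚ
  N = ι (+ n)
  instance
    N>0 : ℚ.Positive N
    N>0 = ι-pos n
    N≢0 : ℚ.NonZero N
    N≢0 = ℚ.pos⇒nonZero N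
  limit : ∃[ p ] Lim s p × N ℚ.* p ≡ quarter ℚ.* ι t
  limit = Lim-divide N s (4*-cancel (λ k → N ℚ.* s k) 4ns⟶t)
  p : ℚ
  p = proj₁ limit
  lem : ∀ m → quarter ℚ.* (ι (+ 2) ℚ.* m) ≡ m ℚ.* ½
  lem = solveℚ 1 (λ m → con quarter :* (con (ι (+ 2)) :* m) := m :* con ½) refl

module _ (L : ValidLattice) (φ : ℝ²) where
  open ValidLattice L
  open Lattice L

  private
    x y : ℕ → ℚ
    x = seq (proj₁ φ)
    y = seq (proj₂ φ)

  module _ {h : ℤ² → ℤ} {T : Pred Domino 0ℓ} (tiling : IsTiling T)
           (heightFunction : IsHeightFunction T h) (isFlux : IsFlux L h φ) where
    open TilingHeight tiling heightFunction

    private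
      flux₀ : ∀ {v t} → v ∈ ⟦ L ⟧ → h v ≡ t → Lim (λ k → four ℚ.* seq ⟨ φ , v ⟩ k) (ι t)
      flux₀ {v} v∈L refl = subst (Lim _) (cong ι (trans
        (cong₂ (λ u c → h u ℤ.- c) (⊕-identityˡ v) (IsHeightFunction.origin heightFunction))
        (ℤ.+-identityʳ (h v)))) (lim (isFlux v v∈L 𝟎))

    flux-𝓔 : ∀ {v} → v ∈ ⟦ L ⟧ → v ∈ 𝓔 → ∃[ k ] ⟨ φ , v ⟩ ≈ fromℤ k
    flux-𝓔 {v} v∈L v∈𝓔 with height-𝓔 v v∈𝓔
    ... | mod₄ k eq = k , Lim.close (subst (Lim (seq ⟨ φ , v ⟩))
            (trans (cong (λ i → quarter ℚ.* ι i) (ℤ.+-identityˡ (+ 4 ℤ.* k)))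
                   (trans (cong (quarter ℚ.*_) (ι-4* k)) (lem (ι k))))
            (4*-cancel (seq ⟨ φ , v ⟩) (flux₀ v∈L eq)))
      where
      lem : ∀ x → quarter ℚ.* (four ℚ.* x) ≡ x
      lem = solveℚ 1 (λ x → con quarter :* (con four :* x) := x) refl

    flux-𝓞 : ∀ {v} → v ∈ ⟦ L ⟧ → v ∈ 𝓞 → ∃[ k ] ⟨ φ , v ⟩ ≈ fromℤ k + fromℚ ½
    flux-𝓞 {v} v∈L v∈𝓞 with height-𝓞 v v∈𝓞
    ... | mod₄ k eq = k , Lim.close (subst (Lim (seq ⟨ φ , v ⟩))
            (trans (cong (quarter ℚ.*_) (trans (ι-+ (+ 2) (+ 4 ℤ.* k)) (cong (ι (+ 2) ℚ.+_) (ι-4* k))))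
                   (lem (ι k)))
            (4*-cancel (seq ⟨ φ , v ⟩) (flux₀ v∈L eq)))
      where
      lem : ∀ x → quarter ℚ.* (ι (+ 2) ℚ.+ four ℚ.* x) ≡ x ℚ.+ ½
      lem = solveℚ 1 (λ x → con quarter :* (con (ι (+ 2)) :+ con four :* x) := x :+ con ½) refl

    flux∈♯ : φ ∈ L ♯
    flux∈♯ = (flux-𝓔 v₀∈L , flux-𝓞 v₀∈L) , (flux-𝓔 v₁∈L , flux-𝓞 v₁∈L)

    -- The limits are taken of x + y and x - y. At each index `k`, |x k| + |y k| equals |x k + y k|
    -- or |x k - y k|, so the two bounds transfer termwise.
    flux∈Q : ∀ n .{{_ : ℕ.NonZero n}} → (+ n , + n) ∈ ⟦ L ⟧ → (+ n , ℤ.- + n) ∈ ⟦ L ⟧ → φ ∈ Q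
    flux∈Q n n,n∈L n,-n∈L ε 0<ε = proj₁ near-p ℕ.⊔ proj₁ near-q , λ k M⊔N≤k →
      conclude (∣p∣+∣q∣≡∣p±q∣ (x k) (y k))
        (below (x k ℚ.+ y k) p ∣p∣≤½
          (proj₂ near-p k (ℕ.m⊔n≤o⇒m≤o (proj₁ near-p) (proj₁ near-q) M⊔N≤k)))
        (below (x k ℚ.- y k) q ∣q∣≤½
          (proj₂ near-q k (ℕ.m⊔n≤o⇒n≤o (proj₁ near-p) (proj₁ near-q) M⊔N≤k)))
      where
      N : ℚ
      N = ι (+ n)

      sum-eq : ∀ k → four ℚ.* (N ℚ.* x k ℚ.+ N ℚ.* y k) ≡ four ℚ.* (N ℚ.* (x k ℚ.+ y k))
      sum-eq k = cong (four ℚ.*_) (sym (ℚ.*-distribˡ-+ N (x k) (y k)))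

      difference-eq : ∀ k → four ℚ.* (N ℚ.* x k ℚ.+ ι (ℤ.- + n) ℚ.* y k) ≡
                            four ℚ.* (N ℚ.* (x k ℚ.- y k))
      difference-eq k = cong (four ℚ.*_) (trans
        (cong (λ m → N ℚ.* x k ℚ.+ m ℚ.* y k) (ι-neg (+ n))) (lem N (x k) (y k)))
        where
        lem : ∀ m x y → m ℚ.* x ℚ.+ (ℚ.- m) ℚ.* y ≡ m ℚ.* (x ℚ.- y)
        lem = solveℚ 3 (λ m x y → m :* x :+ (:- m) :* y := m :* (x :- y)) refl

      sum-limit : ∃[ p ] Lim (λ k → x k ℚ.+ y k) p × ℚ.∣ p ∣ ℚ.≤ ½
      sum-limit = Lim-unscale n {t = h (𝟎 ⊕ (+ n , + n)) ℤ.- h 𝟎} (diagonal-bound n)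
        (Lim-cong sum-eq refl (lim (isFlux (+ n , + n) n,n∈L 𝟎)))

      difference-limit : ∃[ p ] Lim (λ k → x k ℚ.- y k) p × ℚ.∣ p ∣ ℚ.≤ ½
      difference-limit = Lim-unscale n {t = h ((0ℤ , 1ℤ) ⊕ (+ n , ℤ.- + n)) ℤ.- h (0ℤ , 1ℤ)} (antidiagonal-bound n)
        (Lim-cong difference-eq refl (lim (isFlux (+ n , ℤ.- + n) n,-n∈L (0ℤ , 1ℤ))))

      p q : ℚ
      p = proj₁ sum-limit
      q = proj₁ difference-limit

      ∣p∣≤½ : ℚ.∣ p ∣ ℚ.≤ ½
      ∣p∣≤½ = proj₂ (proj₂ sum-limit)

      ∣q∣≤½ : ℚ.∣ q ∣ ℚ.≤ ½
      ∣q∣≤½ = proj₂ (proj₂ difference-limit)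

      near-p : ∃[ M ] (∀ k → M ℕ.≤ k → ℚ.∣ (x k ℚ.+ y k) ℚ.- p ∣ ℚ.< ε)
      near-p = Lim.close (proj₁ (proj₂ sum-limit)) ε 0<ε

      near-q : ∃[ M ] (∀ k → M ℕ.≤ k → ℚ.∣ (x k ℚ.- y k) ℚ.- q ∣ ℚ.< ε)
      near-q = Lim.close (proj₁ (proj₂ difference-limit)) ε 0<ε

      below : ∀ z r → ℚ.∣ r ∣ ℚ.≤ ½ → ℚ.∣ z ℚ.- r ∣ ℚ.< ε → ℚ.∣ z ∣ ℚ.< ½ ℚ.+ ε
      below z r ∣r∣≤½ near = ℚ.<-≤-trans (∣∣-near z r near) (ℚ.+-monoˡ-≤ ε ∣r∣≤½)

      conclude : ∀ {s a b c} → s ≡ a ⊎ s ≡ b → a ℚ.< c → b ℚ.< c → s ℚ.< c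
      conclude (inj₁ refl) a<c _ = a<c
      conclude (inj₂ refl) _ b<c = b<c

-- From fluxes to tilings

-- Both kinds of vector give the residue prescribed by `height`: `4k = 2(2a) + 4(k - a)` in `𝓔` and
-- `4k + 2 = 2(2a + 1) + 4(k - a)` in `𝓞`.
flux-numerator : ∀ v → v ∈ 𝓔 ⊎ v ∈ 𝓞 → ∀ z →
  (v ∈ 𝓔 → ∃[ k ] z ≈ fromℤ k) → (v ∈ 𝓞 → ∃[ k ] z ≈ fromℤ k + fromℚ ½) →
  ∃[ m ] Lim (λ k → four ℚ.* seq z k) (ι (+ 2 ℤ.* proj₁ v ℤ.+ + 4 ℤ.* m))
flux-numerator v (inj₁ ((a , b) , refl)) z integral _ with integral ((a , b) , refl)
... | k , z≈k = k ℤ.- a ,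
  subst (Lim _) (trans (sym (ι-4* k)) (cong ι (lem k a))) (Lim-* four {seq z} {ι k} (lim z≈k))
  where
  lem : ∀ k a → + 4 ℤ.* k ≡ + 2 ℤ.* (+ 2 ℤ.* a) ℤ.+ + 4 ℤ.* (k ℤ.- a)
  lem = solve-∀
flux-numerator v (inj₂ ((a , b) , refl)) z _ half-integral with half-integral ((a , b) , refl)
... | k , z≈k+½ = k ℤ.- a , subst (Lim _) eq (Lim-* four {seq z} {ι k ℚ.+ ½} (lim z≈k+½))
  where
  lem : ∀ k a → + 4 ℤ.* k ℤ.+ + 2 ≡ + 2 ℤ.* (+ 2 ℤ.* a ℤ.+ 1ℤ) ℤ.+ + 4 ℤ.* (k ℤ.- a)
  lem = solve-∀
  eq : four ℚ.* (ι k ℚ.+ ½) ≡ ι (+ 2 ℤ.* (+ 2 ℤ.* a ℤ.+ 1ℤ) ℤ.+ + 4 ℤ.* (k ℤ.- a))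
  eq = trans (ℚ.*-distribˡ-+ four (ι k) ½) (trans (cong (ℚ._+ ι (+ 2)) (sym (ι-4* k)))
    (trans (sym (ι-+ (+ 4 ℤ.* k) (+ 2))) (cong ι (lem k a))))

limit-in-Q : ∀ (φ : ℝ²) {p q} → φ ∈ Q → Lim (seq (proj₁ φ)) p → Lim (seq (proj₂ φ)) q →
             ℚ.∣ p ∣ ℚ.+ ℚ.∣ q ∣ ℚ.≤ ½
limit-in-Q φ {p} {q} φ∈Q x⟶p y⟶q = ≤-+ε bound
  where
  -- One third of ε for each coordinate and one for the slack in `φ∈Q`, all at a common index.
  third : ℚ
  third = + 1 ℚ./ 3
  x y : ℕ → ℚ
  x = seq (proj₁ φ)
  y = seq (proj₂ φ)
  bound : ∀ ε → 0ℚ ℚ.< ε → ℚ.∣ p ∣ ℚ.+ ℚ.∣ q ∣ ℚ.< ½ ℚ.+ ε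
  bound ε 0<ε
    with Lim.close x⟶p (third ℚ.* ε) (scale-pos third 0<ε)
       | Lim.close y⟶q (third ℚ.* ε) (scale-pos third 0<ε)
       | φ∈Q (third ℚ.* ε) (scale-pos third 0<ε)
  ... | K , near-p | M , near-q | N , small = begin-strict
    ℚ.∣ p ∣ ℚ.+ ℚ.∣ q ∣                                   <⟨ ℚ.+-mono-< (∣∣-near p (x k) (subst (ℚ._< δ) (∣p-q∣≡∣q-p∣ (x k) p) (near-p k K≤k)))
                                                                       (∣∣-near q (y k) (subst (ℚ._< δ) (∣p-q∣≡∣q-p∣ (y k) q) (near-q k M≤k))) ⟩
    (ℚ.∣ x k ∣ ℚ.+ δ) ℚ.+ (ℚ.∣ y k ∣ ℚ.+ δ)               ≡⟨ collect ℚ.∣ x k ∣ ℚ.∣ y k ∣ δ ⟩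
    (ℚ.∣ x k ∣ ℚ.+ ℚ.∣ y k ∣) ℚ.+ (δ ℚ.+ δ)               <⟨ ℚ.+-monoˡ-< (δ ℚ.+ δ) (small k N≤k) ⟩
    (½ ℚ.+ δ) ℚ.+ (δ ℚ.+ δ)                               ≡⟨ thirds ½ ε ⟩
    ½ ℚ.+ ε                                               ∎
    where
    open ℚ.≤-Reasoning
    δ : ℚ
    δ = third ℚ.* ε
    k : ℕ
    k = K ℕ.⊔ (M ℕ.⊔ N)
    K≤k : K ℕ.≤ k
    K≤k = ℕ.m≤m⊔n K (M ℕ.⊔ N)
    M≤k : M ℕ.≤ k
    M≤k = ℕ.≤-trans (ℕ.m≤m⊔n M N) (ℕ.m≤n⊔m K (M ℕ.⊔ N))
    N≤k : N ℕ.≤ k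
    N≤k = ℕ.≤-trans (ℕ.m≤n⊔m M N) (ℕ.m≤n⊔m K (M ℕ.⊔ N))
    collect : ∀ a b d → (a ℚ.+ d) ℚ.+ (b ℚ.+ d) ≡ (a ℚ.+ b) ℚ.+ (d ℚ.+ d)
    collect = solveℚ 3 (λ a b d → (a :+ d) :+ (b :+ d) := (a :+ b) :+ (d :+ d)) refl
    thirds : ∀ h e → (h ℚ.+ third ℚ.* e) ℚ.+ (third ℚ.* e ℚ.+ third ℚ.* e) ≡ h ℚ.+ e
    thirds = solveℚ 2 (λ h e → (h :+ con third :* e) :+ (con third :* e :+ con third :* e) := h :+ e) refl

numerator-bound : ∀ n P R {p q} .{{_ : ℕ.NonZero n}} →
  ι (+ (4 ℕ.* n)) ℚ.* p ≡ ι P → ι (+ (4 ℕ.* n)) ℚ.* q ≡ ι R →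
  ℚ.∣ p ∣ ℚ.+ ℚ.∣ q ∣ ℚ.≤ ½ → ∣ P ∣ ℕ.+ ∣ R ∣ ℕ.≤ 2 ℕ.* n
numerator-bound n P R {p} {q} Np≡P Nq≡R p+q≤½ = ℤ.drop‿+≤+ (ι-cancel-≤ (begin
  ι (+ (∣ P ∣ ℕ.+ ∣ R ∣))                    ≡⟨ trans (cong ι (ℤ.pos-+ ∣ P ∣ ∣ R ∣)) (ι-+ (+ ∣ P ∣) (+ ∣ R ∣)) ⟩
  ι (+ ∣ P ∣) ℚ.+ ι (+ ∣ R ∣)                ≡⟨ cong₂ ℚ._+_ (∣numerator∣ P Np≡P) (∣numerator∣ R Nq≡R) ⟩
  N ℚ.* ℚ.∣ p ∣ ℚ.+ N ℚ.* ℚ.∣ q ∣            ≡⟨ ℚ.*-distribˡ-+ N ℚ.∣ p ∣ ℚ.∣ q ∣ ⟨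
  N ℚ.* (ℚ.∣ p ∣ ℚ.+ ℚ.∣ q ∣)                ≤⟨ ℚ.*-monoˡ-≤-nonNeg N {{ℚ.pos⇒nonNeg N {{N>0}}}} p+q≤½ ⟩
  N ℚ.* ½                                    ≡⟨ N*½ ⟩
  ι (+ (2 ℕ.* n))                            ∎))
  where
  open ℚ.≤-Reasoning
  N : ℚ
  N = ι (+ (4 ℕ.* n))
  N>0 : ℚ.Positive N
  N>0 = ι-pos (4 ℕ.* n) {{ℕ.m*n≢0 4 n}}
  ∣numerator∣ : ∀ P {p} → N ℚ.* p ≡ ι P → ι (+ ∣ P ∣) ≡ N ℚ.* ℚ.∣ p ∣
  ∣numerator∣ P {p} eq = trans (sym (ι-∣∣ P)) (trans (cong ℚ.∣_∣ (sym eq))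
    (trans (ℚ.∣p*q∣≡∣p∣*∣q∣ N p)
           (cong (ℚ._* ℚ.∣ p ∣) (ι-∣∣ (+ (4 ℕ.* n))))))
  N*½ : N ℚ.* ½ ≡ ι (+ (2 ℕ.* n))
  N*½ = trans (cong (ℚ._* ½) (trans (cong ι (ℤ.pos-* 4 n)) (ι-* (+ 4) (+ n))))
    (trans (lem (ι (+ n))) (sym (trans (cong ι (ℤ.pos-* 2 n)) (ι-* (+ 2) (+ n)))))
    where
    lem : ∀ m → ι (+ 4) ℚ.* m ℚ.* ½ ≡ ι (+ 2) ℚ.* m
    lem = solveℚ 1 (λ m → con (ι (+ 4)) :* m :* con ½ := con (ι (+ 2)) :* m) refl

ι-linear : ∀ a b c d → ι (a ℤ.* b ℤ.+ c ℤ.* d) ≡ ι a ℚ.* ι b ℚ.+ ι c ℚ.* ι d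
ι-linear a b c d = trans (ι-+ (a ℤ.* b) (c ℤ.* d)) (cong₂ ℚ._+_ (ι-* a b) (ι-* c d))

ι-det : ∀ a b c d → ι (a ℤ.* b ℤ.- c ℤ.* d) ≡ ι a ℚ.* ι b ℚ.- ι c ℚ.* ι d
ι-det a b c d = trans (ι-+ (a ℤ.* b) (ℤ.- (c ℤ.* d)))
  (cong₂ ℚ._+_ (ι-* a b) (trans (ι-neg (c ℤ.* d)) (cong ℚ.-_ (ι-* c d))))

-- Cramer's rule for the flux and quasiperiodicity of the rounded height

module Construction (L : ValidLattice) (φ : ℝ²) (φ∈Q : φ ∈ Q) (m₀ m₁ : ℤ)
  (limit₀ : Lim (λ k → four ℚ.* seq ⟨ φ , ValidLattice.v₀ L ⟩ k)
                (ι (+ 2 ℤ.* proj₁ (ValidLattice.v₀ L) ℤ.+ + 4 ℤ.* m₀)))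
  (limit₁ : Lim (λ k → four ℚ.* seq ⟨ φ , ValidLattice.v₁ L ⟩ k)
                (ι (+ 2 ℤ.* proj₁ (ValidLattice.v₁ L) ℤ.+ + 4 ℤ.* m₁)))
  (n : ℕ) (n≢0 : ℕ.NonZero n) (+n≡ : + n ≡ Lattice.det L ℤ.* Lattice.det L) where
  open ValidLattice L
  open Lattice L using (a₀; b₀; a₁; b₁; det; ∈L⇒even)

  private instance
    nonZero : ℕ.NonZero n
    nonZero = n≢0

  x y : ℕ → ℚ
  x = seq (proj₁ φ)
  y = seq (proj₂ φ)

  -- Here `t₀` and `t₁` are the values of `4⟨φ,v₀⟩` and `4⟨φ,v₁⟩`. Cramer's rule gives `4φ` with
  -- denominator `det`; expanding by `det` makes the denominator `n`, which is positive.
  t₀ t₁ P R : ℤ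
  t₀ = + 2 ℤ.* a₀ ℤ.+ + 4 ℤ.* m₀
  t₁ = + 2 ℤ.* a₁ ℤ.+ + 4 ℤ.* m₁
  P = det ℤ.* (b₁ ℤ.* t₀ ℤ.- b₀ ℤ.* t₁)
  R = det ℤ.* (a₀ ℤ.* t₁ ℤ.- a₁ ℤ.* t₀)

  N : ℚ
  N = ι (+ (4 ℕ.* n))

  instance
    N≢0 : ℚ.NonZero N
    N≢0 = ℚ.pos⇒nonZero N {{ι-pos (4 ℕ.* n) {{ℕ.m*n≢0 4 n}}}}

  N≡ : N ≡ four ℚ.* (ι det ℚ.* (ι a₀ ℚ.* ι b₁ ℚ.- ι a₁ ℚ.* ι b₀))
  N≡ = trans (cong ι (trans (ℤ.pos-* 4 n) (cong (ℤ._*_ (+ 4)) +n≡)))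
    (trans (ι-4* (det ℤ.* det)) (cong (four ℚ.*_)
      (trans (ι-* det det) (cong (ι det ℚ.*_) (ι-det a₀ b₁ a₁ b₀)))))

  -- The elimination of `y` is exact at every index, so the convergence of `x` and its value `P / N`
  -- come out together.
  x-limit : ∃[ p ] Lim x p × N ℚ.* p ≡ ι P
  x-limit = Lim-divide N x (Lim-cong
    (λ k → trans (lem four (ι det) (ι a₀) (ι b₀) (ι a₁) (ι b₁) (x k) (y k)) (cong (ℚ._* x k) (sym N≡)))
    (trans (cong (ι det ℚ.*_) (trans (lem′ (ι b₁) (ι t₀) (ι b₀) (ι t₁)) (sym (ι-det b₁ t₀ b₀ t₁))))
           (sym (ι-* det (b₁ ℤ.* t₀ ℤ.- b₀ ℤ.* t₁))))
    (Lim-* (ι det) (Lim-+ (Lim-* (ι b₁) limit₀) (Lim-* (ℚ.- ι b₀) limit₁))))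
    where
    lem : ∀ f d a₀ b₀ a₁ b₁ x y →
      d ℚ.* (b₁ ℚ.* (f ℚ.* (a₀ ℚ.* x ℚ.+ b₀ ℚ.* y)) ℚ.+ (ℚ.- b₀) ℚ.* (f ℚ.* (a₁ ℚ.* x ℚ.+ b₁ ℚ.* y))) ≡
      f ℚ.* (d ℚ.* (a₀ ℚ.* b₁ ℚ.- a₁ ℚ.* b₀)) ℚ.* x
    lem = solveℚ 8 (λ f d a₀ b₀ a₁ b₁ x y →
      d :* (b₁ :* (f :* (a₀ :* x :+ b₀ :* y)) :+ (:- b₀) :* (f :* (a₁ :* x :+ b₁ :* y))) :=
      f :* (d :* (a₀ :* b₁ :- a₁ :* b₀)) :* x) refl
    lem′ : ∀ a b c d → a ℚ.* b ℚ.+ (ℚ.- c) ℚ.* d ≡ a ℚ.* b ℚ.- c ℚ.* d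
    lem′ = solveℚ 4 (λ a b c d → a :* b :+ (:- c) :* d := a :* b :- c :* d) refl

  y-limit : ∃[ q ] Lim y q × N ℚ.* q ≡ ι R
  y-limit = Lim-divide N y (Lim-cong
    (λ k → trans (lem four (ι det) (ι a₀) (ι b₀) (ι a₁) (ι b₁) (x k) (y k)) (cong (ℚ._* y k) (sym N≡)))
    (trans (cong (ι det ℚ.*_) (trans (lem′ (ι a₀) (ι t₁) (ι a₁) (ι t₀)) (sym (ι-det a₀ t₁ a₁ t₀))))
           (sym (ι-* det (a₀ ℤ.* t₁ ℤ.- a₁ ℤ.* t₀))))
    (Lim-* (ι det) (Lim-+ (Lim-* (ι a₀) limit₁) (Lim-* (ℚ.- ι a₁) limit₀))))
    where
    lem : ∀ f d a₀ b₀ a₁ b₁ x y →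
      d ℚ.* (a₀ ℚ.* (f ℚ.* (a₁ ℚ.* x ℚ.+ b₁ ℚ.* y)) ℚ.+ (ℚ.- a₁) ℚ.* (f ℚ.* (a₀ ℚ.* x ℚ.+ b₀ ℚ.* y))) ≡
      f ℚ.* (d ℚ.* (a₀ ℚ.* b₁ ℚ.- a₁ ℚ.* b₀)) ℚ.* y
    lem = solveℚ 8 (λ f d a₀ b₀ a₁ b₁ x y →
      d :* (a₀ :* (f :* (a₁ :* x :+ b₁ :* y)) :+ (:- a₁) :* (f :* (a₀ :* x :+ b₀ :* y))) :=
      f :* (d :* (a₀ :* b₁ :- a₁ :* b₀)) :* y) refl
    lem′ : ∀ a b c d → a ℚ.* b ℚ.+ (ℚ.- c) ℚ.* d ≡ a ℚ.* b ℚ.- c ℚ.* d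
    lem′ = solveℚ 4 (λ a b c d → a :* b :+ (:- c) :* d := a :* b :- c :* d) refl

  bound : ∣ P ∣ ℕ.+ ∣ R ∣ ℕ.≤ 2 ℕ.* n
  bound = numerator-bound n P R (proj₂ (proj₂ x-limit)) (proj₂ (proj₂ y-limit))
    (limit-in-Q φ φ∈Q (proj₁ (proj₂ x-limit)) (proj₁ (proj₂ y-limit)))

  open Rounding n P R bound

  period : ℤ → ℤ → ℤ
  period a b = a ℤ.* m₀ ℤ.+ b ℤ.* m₁

  -- At a lattice vector `4⟨φ,v⟩` is `a t₀ + b t₁`; subtracting twice the first coordinate leaves
  -- `4 (a m₀ + b m₁)`, and the factor `n` completes the multiple of `M` required by `height-⊕`.
  linear-L : ∀ a b → linear (a ⊛ v₀ ⊕ b ⊛ v₁) ≡ period a b ℤ.* + M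
  linear-L a b = begin
    (P ℤ.- + 2 ℤ.* + n) ℤ.* (a ℤ.* a₀ ℤ.+ b ℤ.* a₁) ℤ.+ R ℤ.* (a ℤ.* b₀ ℤ.+ b ℤ.* b₁)
      ≡⟨ cong (λ m → (P ℤ.- + 2 ℤ.* m) ℤ.* (a ℤ.* a₀ ℤ.+ b ℤ.* a₁) ℤ.+ R ℤ.* (a ℤ.* b₀ ℤ.+ b ℤ.* b₁)) +n≡ ⟩
    (P ℤ.- + 2 ℤ.* (det ℤ.* det)) ℤ.* (a ℤ.* a₀ ℤ.+ b ℤ.* a₁) ℤ.+ R ℤ.* (a ℤ.* b₀ ℤ.+ b ℤ.* b₁)
      ≡⟨ regroup det a b a₀ b₀ a₁ b₁ t₀ t₁ ⟩
    det ℤ.* ((a₀ ℤ.* b₁ ℤ.- a₁ ℤ.* b₀) ℤ.* (a ℤ.* t₀ ℤ.+ b ℤ.* t₁)) ℤ.-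
      + 2 ℤ.* (det ℤ.* det) ℤ.* (a ℤ.* a₀ ℤ.+ b ℤ.* a₁)
      ≡⟨ reduce det a b a₀ a₁ m₀ m₁ ⟩
    period a b ℤ.* (+ 4 ℤ.* (det ℤ.* det))
      ≡⟨ cong (λ m → period a b ℤ.* (+ 4 ℤ.* m)) +n≡ ⟨
    period a b ℤ.* (+ 4 ℤ.* + n)
      ≡⟨ cong (ℤ._*_ (period a b)) (ℤ.pos-* 4 n) ⟨
    period a b ℤ.* + M ∎
    where
    open ≡-Reasoning
    regroup : ∀ d a b a₀ b₀ a₁ b₁ t₀ t₁ →
      (d ℤ.* (b₁ ℤ.* t₀ ℤ.- b₀ ℤ.* t₁) ℤ.- + 2 ℤ.* (d ℤ.* d)) ℤ.* (a ℤ.* a₀ ℤ.+ b ℤ.* a₁) ℤ.+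
        d ℤ.* (a₀ ℤ.* t₁ ℤ.- a₁ ℤ.* t₀) ℤ.* (a ℤ.* b₀ ℤ.+ b ℤ.* b₁) ≡
      d ℤ.* ((a₀ ℤ.* b₁ ℤ.- a₁ ℤ.* b₀) ℤ.* (a ℤ.* t₀ ℤ.+ b ℤ.* t₁)) ℤ.-
        + 2 ℤ.* (d ℤ.* d) ℤ.* (a ℤ.* a₀ ℤ.+ b ℤ.* a₁)
    regroup = solve-∀
    reduce : ∀ d a b a₀ a₁ m₀ m₁ →
      d ℤ.* (d ℤ.* (a ℤ.* (+ 2 ℤ.* a₀ ℤ.+ + 4 ℤ.* m₀) ℤ.+ b ℤ.* (+ 2 ℤ.* a₁ ℤ.+ + 4 ℤ.* m₁))) ℤ.-
        + 2 ℤ.* (d ℤ.* d) ℤ.* (a ℤ.* a₀ ℤ.+ b ℤ.* a₁) ≡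
      (a ℤ.* m₀ ℤ.+ b ℤ.* m₁) ℤ.* (+ 4 ℤ.* (d ℤ.* d))
    reduce = solve-∀

  height-L : ∀ a b u → height (u ⊕ (a ⊛ v₀ ⊕ b ⊛ v₁)) ≡ height u ℤ.+ (a ℤ.* t₀ ℤ.+ b ℤ.* t₁)
  height-L a b u = trans
    (height-⊕ (a ⊛ v₀ ⊕ b ⊛ v₁) (period a b) (∈L⇒even (a , b , refl)) (linear-L a b) u)
    (cong (ℤ._+_ (height u)) (lem a b a₀ a₁ m₀ m₁))
    where
    lem : ∀ a b a₀ a₁ m₀ m₁ →
      + 2 ℤ.* (a ℤ.* a₀ ℤ.+ b ℤ.* a₁) ℤ.+ + 4 ℤ.* (a ℤ.* m₀ ℤ.+ b ℤ.* m₁) ≡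
      a ℤ.* (+ 2 ℤ.* a₀ ℤ.+ + 4 ℤ.* m₀) ℤ.+ b ℤ.* (+ 2 ℤ.* a₁ ℤ.+ + 4 ℤ.* m₁)
    lem = solve-∀

  flux-combination : ∀ a b →
    Lim (λ k → four ℚ.* seq ⟨ φ , a ⊛ v₀ ⊕ b ⊛ v₁ ⟩ k) (ι (a ℤ.* t₀ ℤ.+ b ℤ.* t₁))
  flux-combination a b = Lim-cong
    (λ k → trans (lem four (ι a) (ι b) (ι a₀) (ι b₀) (ι a₁) (ι b₁) (x k) (y k))
      (cong₂ (λ c d → four ℚ.* (c ℚ.* x k ℚ.+ d ℚ.* y k))
        (sym (ι-linear a a₀ b a₁)) (sym (ι-linear a b₀ b b₁))))
    (sym (ι-linear a t₀ b t₁))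
    (Lim-+ (Lim-* (ι a) limit₀) (Lim-* (ι b) limit₁))
    where
    lem : ∀ f a b a₀ b₀ a₁ b₁ x y →
      a ℚ.* (f ℚ.* (a₀ ℚ.* x ℚ.+ b₀ ℚ.* y)) ℚ.+ b ℚ.* (f ℚ.* (a₁ ℚ.* x ℚ.+ b₁ ℚ.* y)) ≡
      f ℚ.* ((a ℚ.* a₀ ℚ.+ b ℚ.* a₁) ℚ.* x ℚ.+ (a ℚ.* b₀ ℚ.+ b ℚ.* b₁) ℚ.* y)
    lem = solveℚ 9 (λ f a b a₀ b₀ a₁ b₁ x y →
      a :* (f :* (a₀ :* x :+ b₀ :* y)) :+ b :* (f :* (a₁ :* x :+ b₁ :* y)) :=
      f :* ((a :* a₀ :+ b :* a₁) :* x :+ (a :* b₀ :+ b :* b₁) :* y)) refl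
  height-flux : ∀ a b u → let v = a ⊛ v₀ ⊕ b ⊛ v₁ in
    Lim (λ k → four ℚ.* seq ⟨ φ , v ⟩ k) (ι (height (u ⊕ v) ℤ.- height u))
  height-flux a b u = Lim-cong (λ _ → refl)
    (cong ι {x = a ℤ.* t₀ ℤ.+ b ℤ.* t₁} (trans (lem (height u) (a ℤ.* t₀ ℤ.+ b ℤ.* t₁))
                   (cong (ℤ._- height u) (sym (height-L a b u)))))
    (flux-combination a b)
    where
    lem : ∀ h t → t ≡ h ℤ.+ t ℤ.- h
    lem = solve-∀

  height-isFlux : IsFlux L height φ
  height-isFlux v (a , b , refl) u = Lim.close (height-flux a b u)

  torusTiling : TorusTiling L
  torusTiling = record
    { dominoes = crossed
    ; isTiling = crossed-isTiling
    ; periodic = λ { v (a , b , refl) d d∈T →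
        trans (jump-shift (a ⊛ v₀ ⊕ b ⊛ v₁) (a ℤ.* t₀ ℤ.+ b ℤ.* t₁) (height-L a b) d) d∈T }
    }

  φ∈𝓕 : φ ∈ 𝓕 L
  φ∈𝓕 = torusTiling , height , height-isHeightFunction , height-isFlux

theorem1 : (L : ValidLattice) → 𝓕 L ≐ (L ♯) ∩ Q
theorem1 L = (λ {φ} → flux∈♯∩Q φ) , (λ {φ} → ♯∩Q∈flux φ)
  where
  open ValidLattice L
  open Lattice L using (n; n≢0; +n≡; n,n∈L; n,-n∈L)

  flux∈♯∩Q : ∀ φ → φ ∈ 𝓕 L → φ ∈ (L ♯) ∩ Q
  flux∈♯∩Q φ (t , h , heightFunction , isFlux) =
    flux∈♯ L φ isTiling heightFunction isFlux ,
    flux∈Q L φ isTiling heightFunction isFlux n n,n∈L n,-n∈L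
    where open TorusTiling t using (isTiling)

  ♯∩Q∈flux : ∀ φ → φ ∈ (L ♯) ∩ Q → φ ∈ 𝓕 L
  ♯∩Q∈flux φ (((integral₀ , half₀) , (integral₁ , half₁)) , φ∈Q) =
    Construction.φ∈𝓕 L φ φ∈Q (proj₁ numerator₀) (proj₁ numerator₁)
      (proj₂ numerator₀) (proj₂ numerator₁) n n≢0 +n≡
    where
    numerator₀ : ∃[ m ] Lim (λ k → four ℚ.* seq ⟨ φ , v₀ ⟩ k) (ι (+ 2 ℤ.* proj₁ v₀ ℤ.+ + 4 ℤ.* m))
    numerator₀ = flux-numerator v₀ v₀∈𝓔⊎𝓞 ⟨ φ , v₀ ⟩ integral₀ half₀
    numerator₁ : ∃[ m ] Lim (λ k → four ℚ.* seq ⟨ φ , v₁ ⟩ k) (ι (+ 2 ℤ.* proj₁ v₁ ℤ.+ + 4 ℤ.* m))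
    numerator₁ = flux-numerator v₁ v₁∈𝓔⊎𝓞 ⟨ φ , v₁ ⟩ integral₁ half₁
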